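{- Let $B$ be an $n\times n$ complex Hermitian matrix with $\operatorname{sepr}(B)=t_1t_2\cdots t_n$. Then there is no $k\in\{1,\dots,n-1\}$ with $t_kt_{k+1}=\mathtt{A^*N}$, and there is no $k\in\{1,\dots,n-1\}$ with $t_kt_{k+1}=\mathtt{NA^*}$. That is, neither $\mathtt{A^*N}$ nor $\mathtt{NA^*}$ can occur as a subsequence (of consecutive terms) of the sepr-sequence of a Hermitian matrix.
   Context: A principal minor of order $k$ of an $n\times n$ matrix is the determinant of a $k\times k$ principal submatrix (same row and column index set). The signed enhanced principal rank characteristic sequence (sepr-sequence) of an $n\times n$ complex Hermitian matrix $B$ is $\operatorname{sepr}(B)=t_1t_2\cdots t_n$, where: $t_k=\mathtt{A^*}$ if all order-$k$ principal minors are nonzero and there are both a positive and a negative one; $t_k=\mathtt{A^+}$ (resp. $\mathtt{A^- }$) if all order-$k$ principal minors are positive (resp. negative); $t_k=\mathtt{N}$ if all are zero; $t_k=\mathtt{S^*}$ if there are a positive, a negative and a zero order-$k$ principal minor; $t_k=\mathtt{S^+}$ (resp. $\mathtt{S^- }$) if there are both a zero and a nonzero order-$k$ principal minor, and every nonzero one is positive (resp. negative). -}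

module Defs where

open import Algebra.Bundles using (CommutativeMonoid; RawRing)
import Algebra.Definitions.RawSemiring as RawSemiringDefs
import Algebra.Properties.AbelianGroup as AbelianGroupProperties
import Algebra.Properties.CommutativeSemigroup as CommutativeSemigroupProperties
import Algebra.Properties.Ring as RingProperties
open import Data.Fin.Base using (Fin; zero; suc; toℕ; punchIn)
open import Data.Fin.Subset using (Subset; inside; outside; ∣_∣)
open import Data.Nat.Base as ℕ using (ℕ; zero; suc)
import Data.Nat.Properties as ℕ
open import Data.Product.Base using (∃; ∃₂; _×_; _,_; proj₁; proj₂)
open import Data.Rational.Base as ℚ using (ℚ; 0ℚ; 1ℚ; ½)
import Data.Rational.Properties as ℚ
open import Data.Vec.Base using ([]; _∷_)
open import Data.Vec.Functional using (Vector)
open import Level using (0ℓ)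
open import Relation.Binary.PropositionalEquality
  using (_≡_; sym; trans; cong; cong₂; subst)
open import Relation.Nullary.Negation using (¬_)

-- A real number is a Cauchy sequence of rationals; sequences whose
-- difference tends to 0 are identified by the setoid equality _≈ℝ_.

Cauchy : (ℕ → ℚ) → Set
Cauchy s = ∀ ε → 0ℚ ℚ.< ε →
  ∃ λ N → ∀ m n → N ℕ.≤ m → N ℕ.≤ n → ℚ.∣ s m ℚ.- s n ∣ ℚ.< ε

record ℝ : Set where
  constructor mkℝ
  field
    seq    : ℕ → ℚ
    cauchy : Cauchy seq

open ℝ public

infix 4 _≈ℝ_ _<ℝ_

_≈ℝ_ : ℝ → ℝ → Set
x ≈ℝ y = ∀ ε → 0ℚ ℚ.< ε →
  ∃ λ N → ∀ n → N ℕ.≤ n → ℚ.∣ seq x n ℚ.- seq y n ∣ ℚ.< ε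

-- The gap ε has to be uniform: a pointwise strict inequality between
-- the sequences would only give x ≤ y in the limit.
_<ℝ_ : ℝ → ℝ → Set
x <ℝ y = ∃ λ ε → 0ℚ ℚ.< ε ×
  ∃ λ N → ∀ n → N ℕ.≤ n → seq x n ℚ.+ ε ℚ.< seq y n

open RingProperties ℚ.+-*-ring using (x[y-z]≈xy-xz; [y-z]x≈yx-zx)
open AbelianGroupProperties ℚ.+-0-abelianGroup using (//-rightDividesˡ)
open CommutativeSemigroupProperties
  (CommutativeMonoid.commutativeSemigroup ℚ.+-0-commutativeMonoid)
  using (interchange)

abstract

  cauchy-const : ∀ q → Cauchy (λ _ → q)
  cauchy-const q ε 0<ε = 0 , λ _ _ _ _ →
    subst (ℚ._< ε) (sym (cong ℚ.∣_∣ (ℚ.+-inverseʳ q))) 0<ε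

  cauchy-neg : ∀ s → Cauchy s → Cauchy (λ n → ℚ.- s n)
  cauchy-neg s cs ε 0<ε with cs ε 0<ε
  ... | N , close = N , λ m n N≤m N≤n →
    subst (ℚ._< ε)
      (trans (sym (ℚ.∣-p∣≡∣p∣ (s m ℚ.- s n)))
             (cong ℚ.∣_∣ (ℚ.neg-distrib-+ (s m) (ℚ.- s n))))
      (close m n N≤m N≤n)

  cauchy-+ : ∀ s t → Cauchy s → Cauchy t → Cauchy (λ n → s n ℚ.+ t n)
  cauchy-+ s t cs ct ε 0<ε = M ℕ.⊔ N , close
    where
    δ : ℚ
    δ = ½ ℚ.* ε

    0<δ : 0ℚ ℚ.< δ
    0<δ = ℚ.*-monoʳ-<-pos ½ 0<ε

    M N : ℕ
    M = proj₁ (cs δ 0<δ)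
    N = proj₁ (ct δ 0<δ)

    regroup : ∀ a b c d →
      (a ℚ.- b) ℚ.+ (c ℚ.- d) ≡ (a ℚ.+ c) ℚ.- (b ℚ.+ d)
    regroup a b c d = trans
      (interchange a (ℚ.- b) c (ℚ.- d))
      (cong ((a ℚ.+ c) ℚ.+_) (sym (ℚ.neg-distrib-+ b d)))

    halves : δ ℚ.+ δ ≡ ε
    halves = trans (sym (ℚ.*-distribʳ-+ ε ½ ½)) (ℚ.*-identityˡ ε)

    close : ∀ m n → M ℕ.⊔ N ℕ.≤ m → M ℕ.⊔ N ℕ.≤ n →
      ℚ.∣ (s m ℚ.+ t m) ℚ.- (s n ℚ.+ t n) ∣ ℚ.< ε
    close m n ≤m ≤n = begin-strict
      ℚ.∣ (s m ℚ.+ t m) ℚ.- (s n ℚ.+ t n) ∣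
        ≡⟨ cong ℚ.∣_∣ (regroup (s m) (s n) (t m) (t n)) ⟨
      ℚ.∣ (s m ℚ.- s n) ℚ.+ (t m ℚ.- t n) ∣
        ≤⟨ ℚ.∣p+q∣≤∣p∣+∣q∣ (s m ℚ.- s n) (t m ℚ.- t n) ⟩
      ℚ.∣ s m ℚ.- s n ∣ ℚ.+ ℚ.∣ t m ℚ.- t n ∣
        <⟨ ℚ.+-mono-<
             (proj₂ (cs δ 0<δ) m n (ℕ.m⊔n≤o⇒m≤o M N ≤m) (ℕ.m⊔n≤o⇒m≤o M N ≤n))
             (proj₂ (ct δ 0<δ) m n (ℕ.m⊔n≤o⇒n≤o M N ≤m) (ℕ.m⊔n≤o⇒n≤o M N ≤n)) ⟩
      δ ℚ.+ δ
        ≡⟨ halves ⟩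
      ε ∎
      where open ℚ.≤-Reasoning

  cauchy⇒bounded : ∀ s → Cauchy s →
    ∃₂ λ K N → 0ℚ ℚ.< K × (∀ n → N ℕ.≤ n → ℚ.∣ s n ∣ ℚ.≤ K)
  cauchy⇒bounded s cs = K , N , 0<K , bound
    where
    0<1 : 0ℚ ℚ.< 1ℚ
    0<1 = ℚ.positive⁻¹ 1ℚ

    N : ℕ
    N = proj₁ (cs 1ℚ 0<1)

    K : ℚ
    K = 1ℚ ℚ.+ ℚ.∣ s N ∣

    0<K : 0ℚ ℚ.< K
    0<K = ℚ.+-mono-<-≤ 0<1 (ℚ.0≤∣p∣ (s N))

    cancel : ∀ a b → a ≡ (a ℚ.- b) ℚ.+ b
    cancel a b = sym (//-rightDividesˡ b a)

    bound : ∀ n → N ℕ.≤ n → ℚ.∣ s n ∣ ℚ.≤ K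
    bound n N≤n = begin
      ℚ.∣ s n ∣
        ≡⟨ cong ℚ.∣_∣ (cancel (s n) (s N)) ⟩
      ℚ.∣ (s n ℚ.- s N) ℚ.+ s N ∣
        ≤⟨ ℚ.∣p+q∣≤∣p∣+∣q∣ (s n ℚ.- s N) (s N) ⟩
      ℚ.∣ s n ℚ.- s N ∣ ℚ.+ ℚ.∣ s N ∣
        ≤⟨ ℚ.+-monoˡ-≤ ℚ.∣ s N ∣
             (ℚ.<⇒≤ (proj₂ (cs 1ℚ 0<1) n N N≤n ℕ.≤-refl)) ⟩
      K ∎
      where open ℚ.≤-Reasoning

  cauchy-* : ∀ s t → Cauchy s → Cauchy t → Cauchy (λ n → s n ℚ.* t n)
  cauchy-* s t cs ct ε 0<ε
    with cauchy⇒bounded s cs | cauchy⇒bounded t ct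
  ... | K , P , 0<K , boundₛ | L , Q , 0<L , boundₜ =
    (P ℕ.⊔ Q) ℕ.⊔ (M ℕ.⊔ N) , close
    where
    instance
      K-pos : ℚ.Positive K
      K-pos = ℚ.positive 0<K

      L-pos : ℚ.Positive L
      L-pos = ℚ.positive 0<L

      K+L-pos : ℚ.Positive (K ℚ.+ L)
      K+L-pos = ℚ.pos+pos⇒pos K L

      K+L-nonZero : ℚ.NonZero (K ℚ.+ L)
      K+L-nonZero = ℚ.pos⇒nonZero (K ℚ.+ L)

      1/-pos : ℚ.Positive (ℚ.1/ (K ℚ.+ L))
      1/-pos = ℚ.1/pos⇒pos (K ℚ.+ L)

    δ : ℚ
    δ = ℚ.1/ (K ℚ.+ L) ℚ.* ε

    0<δ : 0ℚ ℚ.< δ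
    0<δ = subst (ℚ._< δ) (ℚ.*-zeroʳ (ℚ.1/ (K ℚ.+ L)))
            (ℚ.*-monoʳ-<-pos (ℚ.1/ (K ℚ.+ L)) 0<ε)

    M N : ℕ
    M = proj₁ (cs δ 0<δ)
    N = proj₁ (ct δ 0<δ)

    regroup : ∀ a b c d →
      a ℚ.* (c ℚ.- d) ℚ.+ (a ℚ.- b) ℚ.* d ≡ a ℚ.* c ℚ.- b ℚ.* d
    regroup a b c d = trans
      (cong₂ ℚ._+_ (x[y-z]≈xy-xz a c d) ([y-z]x≈yx-zx d a b))
      (trans
        (sym (ℚ.+-assoc (a ℚ.* c ℚ.- a ℚ.* d) (a ℚ.* d) (ℚ.- (b ℚ.* d))))
        (cong (ℚ._- (b ℚ.* d)) (//-rightDividesˡ (a ℚ.* d) (a ℚ.* c))))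

    total : K ℚ.* δ ℚ.+ L ℚ.* δ ≡ ε
    total = trans (sym (ℚ.*-distribʳ-+ δ K L))
      (trans (sym (ℚ.*-assoc (K ℚ.+ L) (ℚ.1/ (K ℚ.+ L)) ε))
      (trans (cong (ℚ._* ε) (ℚ.*-inverseʳ (K ℚ.+ L)))
             (ℚ.*-identityˡ ε)))

    product-bound : ∀ a b C .{{_ : ℚ.Positive C}} →
      ℚ.∣ a ∣ ℚ.≤ C → ℚ.∣ b ∣ ℚ.< δ → ℚ.∣ a ℚ.* b ∣ ℚ.< C ℚ.* δ
    product-bound a b C a≤C b<δ = begin-strict
      ℚ.∣ a ℚ.* b ∣         ≡⟨ ℚ.∣p*q∣≡∣p∣*∣q∣ a b ⟩
      ℚ.∣ a ∣ ℚ.* ℚ.∣ b ∣   ≤⟨ ℚ.*-monoʳ-≤-nonNeg ℚ.∣ b ∣ {{ℚ.∣-∣-nonNeg b}} a≤C ⟩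
      C ℚ.* ℚ.∣ b ∣         <⟨ ℚ.*-monoʳ-<-pos C b<δ ⟩
      C ℚ.* δ               ∎
      where open ℚ.≤-Reasoning

    close : ∀ m n → (P ℕ.⊔ Q) ℕ.⊔ (M ℕ.⊔ N) ℕ.≤ m →
      (P ℕ.⊔ Q) ℕ.⊔ (M ℕ.⊔ N) ℕ.≤ n →
      ℚ.∣ s m ℚ.* t m ℚ.- s n ℚ.* t n ∣ ℚ.< ε
    close m n ≤m ≤n = begin-strict
      ℚ.∣ s m ℚ.* t m ℚ.- s n ℚ.* t n ∣
        ≡⟨ cong ℚ.∣_∣ (regroup (s m) (s n) (t m) (t n)) ⟨
      ℚ.∣ s m ℚ.* (t m ℚ.- t n) ℚ.+ (s m ℚ.- s n) ℚ.* t n ∣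
        ≤⟨ ℚ.∣p+q∣≤∣p∣+∣q∣ (s m ℚ.* (t m ℚ.- t n)) ((s m ℚ.- s n) ℚ.* t n) ⟩
      ℚ.∣ s m ℚ.* (t m ℚ.- t n) ∣ ℚ.+ ℚ.∣ (s m ℚ.- s n) ℚ.* t n ∣
        ≡⟨ cong (λ z → ℚ.∣ s m ℚ.* (t m ℚ.- t n) ∣ ℚ.+ ℚ.∣ z ∣)
             (ℚ.*-comm (s m ℚ.- s n) (t n)) ⟩
      ℚ.∣ s m ℚ.* (t m ℚ.- t n) ∣ ℚ.+ ℚ.∣ t n ℚ.* (s m ℚ.- s n) ∣
        <⟨ ℚ.+-mono-<
             (product-bound (s m) (t m ℚ.- t n) K (boundₛ m P≤m)
               (proj₂ (ct δ 0<δ) m n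
                 (ℕ.m⊔n≤o⇒n≤o M N MN≤m) (ℕ.m⊔n≤o⇒n≤o M N MN≤n)))
             (product-bound (t n) (s m ℚ.- s n) L (boundₜ n Q≤n)
               (proj₂ (cs δ 0<δ) m n
                 (ℕ.m⊔n≤o⇒m≤o M N MN≤m) (ℕ.m⊔n≤o⇒m≤o M N MN≤n))) ⟩
      K ℚ.* δ ℚ.+ L ℚ.* δ
        ≡⟨ total ⟩
      ε ∎
      where
      open ℚ.≤-Reasoning
      MN≤m : M ℕ.⊔ N ℕ.≤ m
      MN≤m = ℕ.m⊔n≤o⇒n≤o (P ℕ.⊔ Q) (M ℕ.⊔ N) ≤m
      MN≤n : M ℕ.⊔ N ℕ.≤ n
      MN≤n = ℕ.m⊔n≤o⇒n≤o (P ℕ.⊔ Q) (M ℕ.⊔ N) ≤n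
      P≤m : P ℕ.≤ m
      P≤m = ℕ.m⊔n≤o⇒m≤o P Q (ℕ.m⊔n≤o⇒m≤o (P ℕ.⊔ Q) (M ℕ.⊔ N) ≤m)
      Q≤n : Q ℕ.≤ n
      Q≤n = ℕ.m⊔n≤o⇒n≤o P Q (ℕ.m⊔n≤o⇒m≤o (P ℕ.⊔ Q) (M ℕ.⊔ N) ≤n)

infixl 6 _+ℝ_
infixl 7 _*ℝ_
infix  8 -ℝ_

fromℚ : ℚ → ℝ
fromℚ q = mkℝ (λ _ → q) (cauchy-const q)

0ℝ 1ℝ : ℝ
0ℝ = fromℚ 0ℚ
1ℝ = fromℚ 1ℚ

_+ℝ_ _*ℝ_ : ℝ → ℝ → ℝ
x +ℝ y = mkℝ (λ n → seq x n ℚ.+ seq y n)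
  (cauchy-+ (seq x) (seq y) (cauchy x) (cauchy y))
x *ℝ y = mkℝ (λ n → seq x n ℚ.* seq y n)
  (cauchy-* (seq x) (seq y) (cauchy x) (cauchy y))

-ℝ_ : ℝ → ℝ
-ℝ x = mkℝ (λ n → ℚ.- seq x n) (cauchy-neg (seq x) (cauchy x))

record ℂ : Set where
  constructor _+i_
  field
    re : ℝ
    im : ℝ

open ℂ public

infix  4 _≈ℂ_
infixl 6 _+ℂ_
infixl 7 _*ℂ_
infix  8 -ℂ_

_≈ℂ_ : ℂ → ℂ → Set
z ≈ℂ w = re z ≈ℝ re w × im z ≈ℝ im w

0ℂ 1ℂ : ℂ
0ℂ = 0ℝ +i 0ℝ
1ℂ = 1ℝ +i 0ℝ

_+ℂ_ _*ℂ_ : ℂ → ℂ → ℂ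
z +ℂ w = (re z +ℝ re w) +i (im z +ℝ im w)
z *ℂ w = (re z *ℝ re w +ℝ -ℝ (im z *ℝ im w)) +i
         (re z *ℝ im w +ℝ im z *ℝ re w)

-ℂ_ : ℂ → ℂ
-ℂ z = (-ℝ re z) +i (-ℝ im z)

conj : ℂ → ℂ
conj z = re z +i (-ℝ im z)

ℂ-rawRing : RawRing 0ℓ 0ℓ
ℂ-rawRing = record
  { Carrier = ℂ
  ; _≈_     = _≈ℂ_
  ; _+_     = _+ℂ_
  ; _*_     = _*ℂ_
  ; -_      = -ℂ_
  ; 0#      = 0ℂ
  ; 1#      = 1ℂ
  }

-- Order statements about a complex number include the assertion that
-- it is real.
Zero Nonzero Positive Negative : ℂ → Set
Zero     z = z ≈ℂ 0ℂ
Nonzero  z = ¬ Zero z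
Positive z = im z ≈ℝ 0ℝ × 0ℝ <ℝ re z
Negative z = im z ≈ℝ 0ℝ × re z <ℝ 0ℝ

Matrix : ∀ {a} → Set a → ℕ → Set a
Matrix A n = Fin n → Fin n → A

module Determinant {c ℓ} (R : RawRing c ℓ) where
  open RawRing R
  open RawSemiringDefs rawSemiring using (sum; _^_)

  -- Laplace expansion along the first row.
  det : ∀ {n} → Matrix Carrier n → Carrier
  det {zero}  M = 1#
  det {suc n} M = sum λ j →
    (- 1#) ^ toℕ j * M zero j * det λ i k → M (suc i) (punchIn j k)

open Determinant ℂ-rawRing public using (det)

Hermitian : ∀ {n} → Matrix ℂ n → Set
Hermitian B = ∀ i j → B i j ≈ℂ conj (B j i)

-- The elements of α in increasing order.
element : ∀ {n} (α : Subset n) → Fin ∣ α ∣ → Fin n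
element (inside  ∷ α) zero    = zero
element (inside  ∷ α) (suc i) = suc (element α i)
element (outside ∷ α) i       = suc (element α i)

principalSubmatrix : ∀ {a} {A : Set a} {n} →
  Matrix A n → (α : Subset n) → Matrix A ∣ α ∣
principalSubmatrix B α i j = B (element α i) (element α j)

principalMinor : ∀ {n} → Matrix ℂ n → Subset n → ℂ
principalMinor B α = det (principalSubmatrix B α)

AllMinors SomeMinor : ∀ {n} → Matrix ℂ n → ℕ → (ℂ → Set) → Set
AllMinors B k P = ∀ α → ∣ α ∣ ≡ k → P (principalMinor B α)
SomeMinor B k P = ∃ λ α → ∣ α ∣ ≡ k × P (principalMinor B α)

data Symbol : Set where
  A* A⁺ A⁻ N S* S⁺ S⁻ : Symbol

IsTerm : ∀ {n} → Matrix ℂ n → ℕ → Symbol → Set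
IsTerm B k A* = AllMinors B k Nonzero × SomeMinor B k Positive × SomeMinor B k Negative
IsTerm B k A⁺ = AllMinors B k Positive
IsTerm B k A⁻ = AllMinors B k Negative
IsTerm B k N  = AllMinors B k Zero
IsTerm B k S* = SomeMinor B k Positive × SomeMinor B k Negative × SomeMinor B k Zero
IsTerm B k S⁺ = SomeMinor B k Zero × SomeMinor B k Nonzero ×
                AllMinors B k (λ z → Nonzero z → Positive z)
IsTerm B k S⁻ = SomeMinor B k Zero × SomeMinor B k Nonzero ×
                AllMinors B k (λ z → Nonzero z → Negative z)

-- sepr(B) = t₁t₂⋯tₙ, where tₖ is stored at the index k - 1 of t.  This is
-- a relation because the sign of a real number cannot be computed.
IsSepr : ∀ {n} → Matrix ℂ n → Vector Symbol n → Set
IsSepr B t = ∀ i → IsTerm B (suc (toℕ i)) (t i)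

OccursConsecutively : ∀ {n} → Symbol → Symbol → Vector Symbol n → Set
OccursConsecutively a b t =
  ∃₂ λ i j → toℕ j ≡ suc (toℕ i) × t i ≡ a × t j ≡ b

-- The Desnanot–Jacobi identity for the rows and columns a, b of B[a b γ] is
--   det B[aγ] det B[bγ] − |det B[aγ | bγ]|² = det B[abγ] det B[γ].
-- If all minors of order |γ| or all minors of order |γ| + 2 vanish, the right
-- side is 0, so two nonzero minors of order |γ| + 1 whose index sets differ in
-- one element have the same sign.  Any two index sets of the same size are
-- joined by a chain of such exchanges, so no two minors of order |γ| + 1 have
-- opposite signs.  As the sign of a real number is not decidable, the sign is
-- carried along the chain under a double negation.

module Submission where

open import Algebra.Bundles using (CommutativeRing; RawRing)
import Algebra.Definitions.RawSemiring as RawSemiringDefs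
open import Algebra.Morphism.Structures using (module RingMorphisms)
import Algebra.Properties.Group as GroupProperties
import Algebra.Properties.Ring as RingProperties
import Algebra.Properties.Semiring.Sum as SumProperties
import Algebra.Solver.Ring.NaturalCoefficients.Default as SemiringSolver
open import Data.Empty using (⊥; ⊥-elim)
open import Data.Fin.Base using (Fin; zero; suc; toℕ; punchIn; cast)
open import Data.Fin.Properties using (_≟_; suc-injective; cast-is-id)
open import Data.Fin.Subset using (Subset; inside; outside; ∣_∣)
open import Data.List.Base using (List; []; _∷_; _++_; length; lookup; tabulate; map)
open import Data.List.Membership.DecPropositional using (_∈?_)
open import Data.List.Membership.Propositional using (_∉_)
open import Data.List.Membership.Propositional.Properties using (∈-∃++; ∈-map⁺)
open import Data.List.Properties
  using (length-++; length-tabulate; lookup-tabulate; map-tabulate; ++-identityʳ)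
open import Data.List.Relation.Binary.Permutation.Propositional
  using (_↭_; refl; prep; swap; trans; ↭-sym; ↭-trans; ↭-reflexive; ↭⇒↭ₛ)
open import Data.List.Relation.Binary.Permutation.Propositional.Properties
  using (↭-length; shift; ++⁺ʳ; map⁺; ∈-resp-↭)
import Data.List.Relation.Binary.Permutation.Setoid.Properties as SetoidPermutation
open import Data.List.Relation.Unary.All using ([]; _∷_)
open import Data.List.Relation.Unary.All.Properties using (¬Any⇒All¬; ++⁻ʳ) renaming (++⁺ to All-++⁺)
open import Data.List.Relation.Unary.AllPairs using ([]; _∷_)
open import Data.List.Relation.Unary.Any using (here; there)
open import Data.List.Relation.Unary.Unique.Propositional using (Unique)
open import Data.List.Relation.Unary.Unique.Propositional.Properties
  using (tabulate⁺; Unique[x∷xs]⇒x∉xs)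
open import Data.Nat.Base as ℕ using (ℕ; zero; suc; pred)
import Data.Nat.Properties as ℕ
open import Data.Product.Base using (∃; ∃₂; _×_; _,_; proj₁; proj₂)
open import Data.Rational.Base as ℚ using (ℚ; 0ℚ; 1ℚ; ½)
import Data.Rational.Properties as ℚ
open import Data.Rational.Solver using (module +-*-Solver)
open import Data.Sum.Base using (_⊎_; inj₁; inj₂)
open import Data.Vec.Base as Vec using ([]; _∷_; _[_]≔_)
open import Data.Vec.Functional using (Vector)
open import Level using (0ℓ)
open import Relation.Binary.PropositionalEquality as ≡ using (_≡_)
import Relation.Binary.Reasoning.Setoid as SetoidReasoning
open import Relation.Nullary.Decidable using (yes; no)
open import Relation.Nullary.Negation using (¬_)
open import Defs hiding (det)

-- Determinants over a commutative ring

-- The identity is also needed for matrices of determinant 0, where the usual derivation, which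
-- cancels a factor `det M`, breaks down. Here one double sum is evaluated in two ways, without
-- division, over any commutative ring. The identity singles out the first two rows and columns,
-- whereas `principalMinor` takes its indices in increasing order. Index sets are therefore replaced
-- by duplicate-free lists up to permutation: reordering rows and columns together multiplies the
-- determinant by the square of a sign. Hermitian symmetry enters through conjugation, a ring
-- homomorphism and hence compatible with `det`. It makes the subtracted term a sum of two real
-- squares, which cannot equal the product of a positive and a negative number. This only refutes a
-- change of sign, and `Nonzero` is itself a negation, so one exchange cannot produce a witness of
-- positivity. As the theorem asserts negations, nothing is lost.

module DeterminantProperties {c ℓ} (R : CommutativeRing c ℓ) where
  open CommutativeRing R hiding (zero)
    renaming (refl to ≈-refl; sym to ≈-sym; trans to ≈-trans)
  open Determinant rawRing
  open SumProperties semiring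
    using (sum; sum-cong-≋; ∑-comm; *-distribˡ-sum; *-distribʳ-sum; sum-replicate-zero)
  open RawSemiringDefs (RawRing.rawSemiring rawRing) using (_^_)
  open RingProperties ring using (-1*x≈-x; -‿involutive)
  open GroupProperties +-group using (x∙y⁻¹≈ε⇒x≈y)
  open SetoidReasoning setoid

  open SemiringSolver commutativeSemiring using (solve; con; _:=_; _:+_; _:*_)

  -- Negatives are written - 1# * x throughout, so that the solver for
  -- commutative semirings applies with - 1# as a variable.
  -1*-1≈1 : - 1# * - 1# ≈ 1#
  -1*-1≈1 = ≈-trans (-1*x≈-x (- 1#)) (-‿involutive 1#)

  sign : ∀ {n} → Fin n → Carrier
  sign j = (- 1#) ^ toℕ j

  minor : ∀ {n} → Matrix Carrier (suc n) → Fin (suc n) → Fin (suc n) → Matrix Carrier n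
  minor M r k i j = M (punchIn r i) (punchIn k j)

  square-* : ∀ x y → x * y * (x * y) ≈ x * x * (y * y)
  square-* = solve 2 (λ x y → x :* y :* (x :* y) := x :* x :* (y :* y)) ≈-refl

  infix 4 _≋_
  _≋_ : ∀ {n} → Matrix Carrier n → Matrix Carrier n → Set ℓ
  M ≋ P = ∀ i j → M i j ≈ P i j

  det-cong : ∀ {n} {M P : Matrix Carrier n} → M ≋ P → det M ≈ det P
  det-cong {zero}  M≋P = ≈-refl
  det-cong {suc n} M≋P = sum-cong-≋ {suc n} λ j →
    *-cong (*-congˡ {sign j} (M≋P zero j)) (det-cong λ i k → M≋P (suc i) (punchIn j k))

  -- Both expansions share the corner term. Every other minor of the row expansion still has column
  -- 0 in first place, so induction expands it there; the resulting double sum, read in the other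
  -- order, is the rest of the column expansion.
  det-expand-column : ∀ {n} (M : Matrix Carrier (suc n)) →
    det M ≈ sum λ i → sign i * M i zero * det (minor M i zero)
  det-expand-column {zero}  M = ≈-refl
  det-expand-column {suc n} M = +-congˡ (begin
    sum (λ j → - 1# * sign j * x j * det (minor M zero (suc j)))
      ≈⟨ sum-cong-≋ (λ j → *-congˡ { - 1# * sign j * x j} (det-expand-column (minor M zero (suc j)))) ⟩
    sum (λ j → - 1# * sign j * x j * sum (λ i → sign i * y i * D i j))
      ≈⟨ sum-cong-≋ (λ j → *-distribˡ-sum (- 1# * sign j * x j) (λ i → sign i * y i * D i j)) ⟩
    sum (λ j → sum (λ i → - 1# * sign j * x j * (sign i * y i * D i j)))
      ≈⟨ ∑-comm (λ j i → - 1# * sign j * x j * (sign i * y i * D i j)) ⟩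
    sum (λ i → sum (λ j → - 1# * sign j * x j * (sign i * y i * D i j)))
      ≈⟨ sum-cong-≋ (λ i → sum-cong-≋ (λ j → exchange (- 1#) (sign j) (x j) (sign i) (y i) (D i j))) ⟩
    sum (λ i → sum (λ j → - 1# * sign i * y i * (sign j * x j * D i j)))
      ≈⟨ sum-cong-≋ (λ i → *-distribˡ-sum (- 1# * sign i * y i) (λ j → sign j * x j * D i j)) ⟨
    sum (λ i → - 1# * sign i * y i * sum (λ j → sign j * x j * D i j)) ∎)
    where
    x y : Fin (suc n) → Carrier
    x j = M zero (suc j)
    y i = M (suc i) zero

    D : Fin (suc n) → Fin (suc n) → Carrier
    D i j = det λ r k → M (suc (punchIn i r)) (suc (punchIn j k))

    exchange : ∀ e s a t b d → e * s * a * (t * b * d) ≈ e * t * b * (s * a * d)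
    exchange = solve 6 (λ e s a t b d →
      e :* s :* a :* (t :* b :* d) := e :* t :* b :* (s :* a :* d)) ≈-refl

  det-transpose : ∀ {n} (M : Matrix Carrier n) → det (λ i j → M j i) ≈ det M
  det-transpose {zero}  M = ≈-refl
  det-transpose {suc n} M = ≈-trans
    (sum-cong-≋ λ i → *-congˡ {sign i * M i zero} (det-transpose (minor M i zero)))
    (≈-sym (det-expand-column M))

  -- The terms of the two columns trade places, and their opposite position signs give the factor.
  -- In every later term both columns are still the first two of the minor, so induction applies.
  det-swap-columns : ∀ {n} {M P : Matrix Carrier (suc (suc n))} →
    (∀ i → P i zero ≈ M i (suc zero)) →
    (∀ i → P i (suc zero) ≈ M i zero) →
    (∀ i j → P i (suc (suc j)) ≈ M i (suc (suc j))) →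
    det P ≈ - 1# * det M
  det-swap-columns {n} {M} {P} P₀ P₁ P₂ = begin
    det P
      ≈⟨ +-cong (*-cong (*-congˡ (P₀ zero)) (det-cong minor₀))
           (+-cong (*-cong (*-congˡ (P₁ zero)) (det-cong minor₁)) (sum-cong-≋ (later M P P₀ P₁ P₂))) ⟩
    1# * a * A + (- 1# * 1# * b * B + sum (λ j → - 1# * T j))
      ≈⟨ +-congˡ (+-congˡ (*-distribˡ-sum (- 1#) T)) ⟨
    1# * a * A + (- 1# * 1# * b * B + - 1# * sum T)
      -- To the solver `- 1#` is a variable, so the fact that its square is 1 has to be inserted by
      -- hand.
      ≈⟨ +-congʳ (≈-trans (*-assoc 1# a A) (*-congʳ (≈-sym -1*-1≈1))) ⟩
    (- 1# * - 1#) * (a * A) + (- 1# * 1# * b * B + - 1# * sum T)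
      ≈⟨ regroup (- 1#) a b A B (sum T) ⟨
    - 1# * (1# * b * B + (- 1# * 1# * a * A + sum T)) ∎
    where
    a b A B : Carrier
    a = M zero (suc zero)
    b = M zero zero
    A = det (minor M zero (suc zero))
    B = det (minor M zero zero)

    term : ∀ {n} → Matrix Carrier (suc (suc n)) → Fin n → Carrier
    term M j = sign (suc (suc j)) * M zero (suc (suc j)) * det (minor M zero (suc (suc j)))

    T : Fin n → Carrier
    T = term M

    minor₀ : minor P zero zero ≋ minor M zero (suc zero)
    minor₀ i zero    = P₁ (suc i)
    minor₀ i (suc k) = P₂ (suc i) k

    minor₁ : minor P zero (suc zero) ≋ minor M zero zero
    minor₁ i zero    = P₀ (suc i)
    minor₁ i (suc k) = P₂ (suc i) k

    scale : ∀ e s x d → s * x * (e * d) ≈ e * (s * x * d)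
    scale = solve 4 (λ e s x d → s :* x :* (e :* d) := e :* (s :* x :* d)) ≈-refl

    -- Quantified over the size anew: the index `j` forces `n` to be a successor, so the minor again
    -- has at least two columns.
    later : ∀ {n} (M P : Matrix Carrier (suc (suc n))) →
      (∀ i → P i zero ≈ M i (suc zero)) →
      (∀ i → P i (suc zero) ≈ M i zero) →
      (∀ i j → P i (suc (suc j)) ≈ M i (suc (suc j))) →
      ∀ j → term P j ≈ - 1# * term M j
    later {suc n} M P P₀ P₁ P₂ j = ≈-trans
      (*-cong (*-congˡ (P₂ zero j))
        (det-swap-columns {M = minor M zero (suc (suc j))} {P = minor P zero (suc (suc j))}
          (λ i → P₀ (suc i)) (λ i → P₁ (suc i)) (λ i k → P₂ (suc i) (punchIn j k))))
      (scale (- 1#) (sign (suc (suc j))) _ _)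

    regroup : ∀ e a b A B S →
      e * (1# * b * B + (e * 1# * a * A + S)) ≈ (e * e) * (a * A) + (e * 1# * b * B + e * S)
    regroup = solve 6 (λ e a b A B S →
      e :* (con 1 :* b :* B :+ (e :* con 1 :* a :* A :+ S)) :=
      (e :* e) :* (a :* A) :+ (e :* con 1 :* b :* B :+ e :* S)) ≈-refl

  det-swap-rows : ∀ {n} {M P : Matrix Carrier (suc (suc n))} →
    (∀ j → P zero j ≈ M (suc zero) j) →
    (∀ j → P (suc zero) j ≈ M zero j) →
    (∀ i j → P (suc (suc i)) j ≈ M (suc (suc i)) j) →
    det P ≈ - 1# * det M
  det-swap-rows {M = M} {P} P₀ P₁ P₂ = begin
    det P                         ≈⟨ det-transpose P ⟨
    det (λ i j → P j i)           ≈⟨ det-swap-columns {M = λ i j → M j i} {λ i j → P j i} P₀ P₁ (λ i j → P₂ j i) ⟩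
    - 1# * det (λ i j → M j i)    ≈⟨ *-congˡ (det-transpose M) ⟩
    - 1# * det M                  ∎

  -- For permutations that fix the first row: the factor then arises in the minors alone.
  det-scale : ∀ {n} σ (M P : Matrix Carrier (suc n)) →
    (∀ j → P zero j ≈ M zero j) →
    (∀ j → det (minor P zero j) ≈ σ * det (minor M zero j)) →
    det P ≈ σ * det M
  det-scale {n} σ M P row minors = begin
    sum (λ j → sign j * P zero j * det (minor P zero j))
      ≈⟨ sum-cong-≋ (λ j → ≈-trans (*-cong (*-congˡ (row j)) (minors j))
           (pull (sign j) (M zero j) (det (minor M zero j)))) ⟩
    sum (λ j → σ * (sign j * M zero j * det (minor M zero j)))
      ≈⟨ *-distribˡ-sum σ (λ j → sign j * M zero j * det (minor M zero j)) ⟨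
    σ * det M ∎
    where
    pull : ∀ s x d → s * x * (σ * d) ≈ σ * (s * x * d)
    pull s x d = solve 4 (λ e s x d → s :* x :* (e :* d) := e :* (s :* x :* d)) ≈-refl σ s x d

  sum-zero : ∀ {n} (f : Fin n → Carrier) → (∀ i → f i ≈ 0#) → sum f ≈ 0#
  sum-zero {n} f f≈0 = ≈-trans (sum-cong-≋ f≈0) (sum-replicate-zero n)

  det-minors-zero : ∀ {n} (M : Matrix Carrier (suc n)) →
    (∀ j → det (minor M zero j) ≈ 0#) → det M ≈ 0#
  det-minors-zero M minors = sum-zero (λ j → sign j * M zero j * det (minor M zero j))
    λ j → ≈-trans (*-congˡ (minors j)) (zeroʳ (sign j * M zero j))

  -- Antisymmetry would only give `det M ≈ - 1# * det M`, which does not force 0 in every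
  -- commutative ring. Instead the first two terms cancel, and the later minors inherit the equal
  -- columns.
  det-equal-columns₀₁ : ∀ {n} (M : Matrix Carrier (suc (suc n))) →
    (∀ i → M i zero ≈ M i (suc zero)) → det M ≈ 0#
  det-equal-columns₀₁ {n} M eq = begin
    1# * a * A + (- 1# * 1# * b * B + sum (term M))
      ≈⟨ +-congˡ (+-cong (*-cong (*-congˡ (≈-sym (eq zero))) (det-cong minors))
           (sum-zero (term M) (later M eq))) ⟩
    1# * a * A + (- 1# * 1# * a * A + 0#)
      ≈⟨ solve 3 (λ e a A → con 1 :* a :* A :+ (e :* con 1 :* a :* A :+ con 0) :=
           (con 1 :+ e) :* (a :* A)) ≈-refl (- 1#) a A ⟩
    (1# + - 1#) * (a * A)
      ≈⟨ ≈-trans (*-congʳ (-‿inverseʳ 1#)) (zeroˡ (a * A)) ⟩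
    0# ∎
    where
    a b A B : Carrier
    a = M zero zero
    b = M zero (suc zero)
    A = det (minor M zero zero)
    B = det (minor M zero (suc zero))

    term : ∀ {n} → Matrix Carrier (suc (suc n)) → Fin n → Carrier
    term M j = sign (suc (suc j)) * M zero (suc (suc j)) * det (minor M zero (suc (suc j)))

    minors : minor M zero (suc zero) ≋ minor M zero zero
    minors i zero    = eq (suc i)
    minors i (suc k) = ≈-refl

    later : ∀ {n} (M : Matrix Carrier (suc (suc n))) →
      (∀ i → M i zero ≈ M i (suc zero)) → ∀ j → term M j ≈ 0#
    later {suc n} M eq j = ≈-trans
      (*-congˡ (det-equal-columns₀₁ (minor M zero (suc (suc j))) (λ i → eq (suc i))))
      (zeroʳ (sign (suc (suc j)) * M zero (suc (suc j))))

  -- If the partner of row 0 is not row 1, swapping rows 0 and 1 moves the pair off the first row.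
  -- Every minor along that row then contains the pair, one position closer together.
  det-equal-rows : ∀ {n} (M : Matrix Carrier (suc n)) (l : Fin n) →
    (∀ j → M zero j ≈ M (suc l) j) → det M ≈ 0#
  det-equal-rows {suc n} M zero eq = ≈-trans (≈-sym (det-transpose M))
    (det-equal-columns₀₁ (λ i j → M j i) eq)
  det-equal-rows {suc n} M (suc l) eq = begin
    det M         ≈⟨ det-swap-rows {M = P} {P = M} (λ j → ≈-refl) (λ j → ≈-refl) (λ i j → ≈-refl) ⟩
    - 1# * det P  ≈⟨ *-congˡ (det-minors-zero P λ j →
                       det-equal-rows (minor P zero j) l (λ k → eq (punchIn j k))) ⟩
    - 1# * 0#     ≈⟨ zeroʳ (- 1#) ⟩
    0#            ∎
    where
    P : Matrix Carrier (suc (suc n))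
    P zero          = M (suc zero)
    P (suc zero)    = M zero
    P (suc (suc i)) = M (suc (suc i))

  det-equal-columns : ∀ {n} (M : Matrix Carrier (suc n)) (l : Fin n) →
    (∀ i → M i zero ≈ M i (suc l)) → det M ≈ 0#
  det-equal-columns M l eq = ≈-trans (≈-sym (det-transpose M))
    (det-equal-rows (λ i j → M j i) l eq)

  -- With w the signed maximal minors of the rows other than 0, M w is
  -- det M times the 0th unit vector.  Pairing M w with the cofactors u of
  -- the first column of a matrix on the rows other than 1 gives the right
  -- side; pairing uᵀ M with w gives the left side.
  desnanot-jacobi : ∀ {n} (M : Matrix Carrier (suc (suc n))) →
    det (minor M (suc zero) (suc zero)) * det (minor M zero zero) +
    - 1# * (det (minor M (suc zero) zero) * det (minor M zero (suc zero))) ≈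
    det M * det (minor (minor M zero zero) zero zero)
  desnanot-jacobi {n} M = begin
    det (minor M (suc zero) (suc zero)) * det (minor M zero zero) +
    - 1# * (det (minor M (suc zero) zero) * det (minor M zero (suc zero)))
      ≈⟨ +-cong (*-congʳ (column₀)) (*-congˡ (*-congʳ column₁)) ⟨
    G zero * det (minor M zero zero) + - 1# * (G (suc zero) * det (minor M zero (suc zero)))
      ≈⟨ solve 5 (λ e g x h y → g :* x :+ e :* (h :* y) :=
           g :* (con 1 :* x) :+ (h :* (e :* con 1 :* y) :+ con 0)) ≈-refl
           (- 1#) (G zero) (det (minor M zero zero)) (G (suc zero)) (det (minor M zero (suc zero))) ⟩
    G zero * w zero + (G (suc zero) * w (suc zero) + 0#)
      ≈⟨ +-congˡ (+-congˡ (sum-zero (λ k → G (suc (suc k)) * w (suc (suc k))) λ k →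
           ≈-trans (*-congʳ (columns k)) (zeroˡ (w (suc (suc k)))))) ⟨
    sum (λ j → G j * w j)
      ≈⟨ sum-cong-≋ (λ j → *-distribʳ-sum (w j) (λ i → u i * M (punchIn (suc zero) i) j)) ⟩
    sum (λ j → sum (λ i → u i * M (punchIn (suc zero) i) j * w j))
      ≈⟨ ∑-comm (λ j i → u i * M (punchIn (suc zero) i) j * w j) ⟩
    sum (λ i → sum (λ j → u i * M (punchIn (suc zero) i) j * w j))
      ≈⟨ sum-cong-≋ (λ i → ≈-trans
           (sum-cong-≋ λ j → *-assoc (u i) (M (punchIn (suc zero) i) j) (w j))
           (≈-sym (*-distribˡ-sum (u i) (λ j → M (punchIn (suc zero) i) j * w j)))) ⟩
    sum (λ i → u i * H (punchIn (suc zero) i))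
      ≈⟨ +-cong (*-congˡ {u zero} (row (M zero))) (sum-zero (λ i → u (suc i) * H (suc (suc i))) λ i →
           ≈-trans (*-congˡ (≈-trans (row (M (suc (suc i))))
             (det-equal-rows (M (suc (suc i)) ∷ᵣ λ k → M (suc k)) (suc i) λ j → ≈-refl)))
             (zeroʳ (u (suc i)))) ⟩
    u zero * det (M zero ∷ᵣ λ k → M (suc k)) + 0#
      ≈⟨ +-congʳ (*-congˡ (det-cong restore)) ⟩
    u zero * det M + 0#
      ≈⟨ solve 2 (λ d m → con 1 :* d :* m :+ con 0 := m :* d) ≈-refl
           (det (minor (minor M zero zero) zero zero)) (det M) ⟩
    det M * det (minor (minor M zero zero) zero zero) ∎
    where
    _∷ᵣ_ : ∀ {m k} → (Fin m → Carrier) → (Fin k → Fin m → Carrier) → Fin (suc k) → Fin m → Carrier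
    (v ∷ᵣ P) zero    = v
    (v ∷ᵣ P) (suc i) = P i

    _∷ᶜ_ : ∀ {m k} → (Fin m → Carrier) → (Fin m → Fin k → Carrier) → Fin m → Fin (suc k) → Carrier
    (v ∷ᶜ P) i zero    = v i
    (v ∷ᶜ P) i (suc j) = P i j

    w : Fin (suc (suc n)) → Carrier
    w j = sign j * det (minor M zero j)

    u : Fin (suc n) → Carrier
    u i = sign i * det (λ r k → M (punchIn (suc zero) (punchIn i r)) (suc (suc k)))

    G : Fin (suc (suc n)) → Carrier
    G j = sum λ i → u i * M (punchIn (suc zero) i) j

    H : Fin (suc (suc n)) → Carrier
    H l = sum λ j → M l j * w j

    exchange : ∀ s x d → s * x * d ≈ s * d * x
    exchange = solve 3 (λ s x d → s :* x :* d := s :* d :* x) ≈-refl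

    shuffle : ∀ s x d → x * (s * d) ≈ s * x * d
    shuffle = solve 3 (λ s x d → x :* (s :* d) := s :* x :* d) ≈-refl

    -- Columns `j`, 2, 3, ... of the rows other than 1, whose expansion along the first column is
    -- `G j`. For `j` at least 2 a column is repeated, so only `G zero` and `G (suc zero)` survive.
    bordered : Fin (suc (suc n)) → Matrix Carrier (suc n)
    bordered j = (λ i → M (punchIn (suc zero) i) j) ∷ᶜ λ i k → M (punchIn (suc zero) i) (suc (suc k))

    column : ∀ j → G j ≈ det (bordered j)
    column j = ≈-trans
      (sum-cong-≋ λ i → ≈-sym (exchange (sign i) (M (punchIn (suc zero) i) j)
        (det (λ r k → M (punchIn (suc zero) (punchIn i r)) (suc (suc k))))))
      (≈-sym (det-expand-column (bordered j)))

    column₀ : G zero ≈ det (minor M (suc zero) (suc zero))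
    column₀ = ≈-trans (column zero) (det-cong {M = bordered zero} {minor M (suc zero) (suc zero)} λ where
      i zero    → ≈-refl
      i (suc k) → ≈-refl)

    column₁ : G (suc zero) ≈ det (minor M (suc zero) zero)
    column₁ = ≈-trans (column (suc zero)) (det-cong {M = bordered (suc zero)} {minor M (suc zero) zero} λ where
      i zero    → ≈-refl
      i (suc k) → ≈-refl)

    columns : ∀ k → G (suc (suc k)) ≈ 0#
    columns k = ≈-trans (column (suc (suc k)))
      (det-equal-columns (bordered (suc (suc k))) k λ i → ≈-refl)

    row : ∀ (v : Fin (suc (suc n)) → Carrier) →
      sum (λ j → v j * w j) ≈ det (v ∷ᵣ λ k → M (suc k))
    row v = sum-cong-≋ λ j → shuffle (sign j) (v j) (det (minor M zero j))

    restore : (M zero ∷ᵣ λ k → M (suc k)) ≋ M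
    restore zero    j = ≈-refl
    restore (suc i) j = ≈-refl

  det-hom : ∀ {f} → RingMorphisms.IsRingHomomorphism rawRing rawRing f →
    ∀ {n} (M : Matrix Carrier n) → f (det M) ≈ det (λ i j → f (M i j))
  det-hom {f} hom = go
    where
    open RingMorphisms.IsRingHomomorphism hom

    f-sum : ∀ {n} (t : Fin n → Carrier) → f (sum t) ≈ sum (λ i → f (t i))
    f-sum {zero}  t = 0#-homo
    f-sum {suc n} t = ≈-trans (+-homo _ _) (+-congˡ (f-sum (λ i → t (suc i))))

    f-sign : ∀ {n} (i : Fin n) → f (sign i) ≈ sign i
    f-sign zero    = 1#-homo
    f-sign (suc i) = ≈-trans (*-homo _ _)
      (*-cong (≈-trans (-‿homo 1#) (-‿cong 1#-homo)) (f-sign i))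

    go : ∀ {n} (M : Matrix Carrier n) → f (det M) ≈ det (λ i j → f (M i j))
    go {zero}  M = 1#-homo
    go {suc n} M = ≈-trans (f-sum (λ j → sign j * M zero j * det (minor M zero j)))
      (sum-cong-≋ λ j → ≈-trans (*-homo _ _)
        (*-cong (≈-trans (*-homo (sign j) (M zero j)) (*-congʳ (f-sign j))) (go (minor M zero j))))

  -- With conjugation for `f`, this gives both the reality of principal minors and the conjugacy of
  -- the two off-diagonal minors.
  det-adjoint : ∀ {f} → RingMorphisms.IsRingHomomorphism rawRing rawRing f →
    ∀ {n} (M P : Matrix Carrier n) → (∀ i j → M i j ≈ f (P j i)) → det M ≈ f (det P)
  det-adjoint {f} hom M P adjoint = ≈-trans (det-cong adjoint)
    (≈-trans (det-transpose (λ i j → f (P i j))) (≈-sym (det-hom hom P)))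

  det-reindex : ∀ {k m} (e : k ≡ m) (M : Matrix Carrier m) →
    det (λ i j → M (cast e i) (cast e j)) ≈ det M
  det-reindex ≡.refl M = det-cong λ i j →
    reflexive (≡.cong₂ M (cast-is-id ≡.refl i) (cast-is-id ≡.refl j))

  -- Principal minors indexed by lists, up to permutation

  module _ {a} {A : Set a} where

    -- Computed from the derivation of `xs ↭ ys`. Rows and columns are later permuted by the same
    -- derivation, so only its square enters.
    perm-sign : ∀ {xs ys : List A} → xs ↭ ys → Carrier
    perm-sign refl         = 1#
    perm-sign (prep x p)   = perm-sign p
    perm-sign (swap x y p) = - 1# * perm-sign p
    perm-sign (trans p q)  = perm-sign p * perm-sign q

    perm-sign² : ∀ {xs ys : List A} (p : xs ↭ ys) → perm-sign p * perm-sign p ≈ 1#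
    perm-sign² refl         = *-identityˡ 1#
    perm-sign² (prep x p)   = perm-sign² p
    perm-sign² (swap x y p) = ≈-trans (square-* (- 1#) (perm-sign p))
      (≈-trans (*-cong -1*-1≈1 (perm-sign² p)) (*-identityˡ 1#))
    perm-sign² (trans p q)  = ≈-trans (square-* (perm-sign p) (perm-sign q))
      (≈-trans (*-cong (perm-sign² p) (perm-sign² q)) (*-identityˡ 1#))

    -- The size `k` stays fixed while the list varies, so matrices before and after a permutation
    -- have the same type. As the length equation is irrelevant, its proof does not affect the
    -- matrix.
    rows : ∀ {k m} (xs : List A) → .(k ≡ length xs) →
      (A → Fin m → Carrier) → Fin k → Fin m → Carrier
    rows xs e F i = F (lookup xs (cast e i))

    det-permute-rows : ∀ {k} {xs ys : List A} (p : xs ↭ ys)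
      .(e : k ≡ length xs) .(e′ : k ≡ length ys) (F : A → Fin k → Carrier) →
      det (rows xs e F) ≈ perm-sign p * det (rows ys e′ F)
    det-permute-rows refl e e′ F = ≈-sym (*-identityˡ _)
    det-permute-rows {zero} (prep x p) () e′ F
    det-permute-rows {suc k} (prep {xs} {ys} x p) e e′ F =
      det-scale (perm-sign p) (rows (x ∷ ys) e′ F) (rows (x ∷ xs) e F) (λ j → ≈-refl) λ j →
        det-permute-rows p (≡.cong pred e) (≡.cong pred e′) (λ a i → F a (punchIn j i))
    det-permute-rows {zero} (swap x y p) () e′ F
    det-permute-rows {suc zero} (swap x y p) () e′ F
    det-permute-rows {suc (suc k)} (swap {xs} {ys} x y p) e e′ F = ≈-trans
      (det-swap-rows {M = M} {P = rows (x ∷ y ∷ xs) e F} (λ j → ≈-refl) (λ j → ≈-refl) (λ i j → ≈-refl))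
      (≈-trans
        (*-congˡ (det-scale (perm-sign p) P M (λ j → ≈-refl) λ j →
          det-scale (perm-sign p) (minor P zero j) (minor M zero j) (λ l → ≈-refl) λ l →
            det-permute-rows p (≡.cong pred (≡.cong pred e)) (≡.cong pred (≡.cong pred e′))
              (λ a i → F a (punchIn j (punchIn l i)))))
        (≈-sym (*-assoc (- 1#) (perm-sign p) (det P))))
      where
      M P : Matrix Carrier (suc (suc k))
      M = rows (y ∷ x ∷ xs) e F
      P = rows (y ∷ x ∷ ys) e′ F
    det-permute-rows (trans p q) e e′ F = ≈-trans
      (det-permute-rows p e (≡.trans e (↭-length p)) F)
      (≈-trans (*-congˡ (det-permute-rows q (≡.trans e (↭-length p)) e′ F))
        (≈-sym (*-assoc (perm-sign p) (perm-sign q) _)))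

    module _ (F : A → A → Carrier) where

      principal : (xs : List A) → Matrix Carrier (length xs)
      principal xs i j = F (lookup xs i) (lookup xs j)

      -- Permuting the rows costs a factor `perm-sign p`. Transposing turns the columns into rows,
      -- which the same `p` permutes at the same cost, and the two factors multiply to 1.
      det-principal-↭ : ∀ {xs ys} → xs ↭ ys → det (principal xs) ≈ det (principal ys)
      det-principal-↭ {xs} {ys} p = begin
        det (λ i j → F (x i) (x j))
          ≈⟨ det-cong (λ i j → reflexive (≡.cong (λ l → F (lookup xs l) (x j)) (≡.sym (cast-is-id ≡.refl i)))) ⟩
        det (rows xs ≡.refl (λ a j → F a (x j)))
          ≈⟨ det-permute-rows p ≡.refl e (λ a j → F a (x j)) ⟩
        s * det (λ i j → F (y i) (x j))
          ≈⟨ *-congˡ (≈-sym (det-transpose (λ i j → F (y i) (x j)))) ⟩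
        s * det (λ i j → F (y j) (x i))
          ≈⟨ *-congˡ (det-cong (λ i j → reflexive (≡.cong (λ l → F (y j) (lookup xs l)) (≡.sym (cast-is-id ≡.refl i))))) ⟩
        s * det (rows xs ≡.refl (λ a j → F (y j) a))
          ≈⟨ *-congˡ (det-permute-rows p ≡.refl e (λ a j → F (y j) a)) ⟩
        s * (s * det (λ i j → F (y j) (y i)))
          ≈⟨ ≈-sym (*-assoc s s _) ⟩
        s * s * det (λ i j → F (y j) (y i))
          ≈⟨ *-cong (perm-sign² p) (det-transpose (λ i j → F (y i) (y j))) ⟩
        1# * det (λ i j → F (y i) (y j))
          ≈⟨ *-identityˡ _ ⟩
        det (λ i j → F (y i) (y j))
          ≈⟨ det-reindex e (principal ys) ⟩
        det (principal ys) ∎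
        where
        s : Carrier
        s = perm-sign p

        e : length xs ≡ length ys
        e = ↭-length p

        x y : Fin (length xs) → A
        x i = lookup xs i
        y i = lookup ys (cast e i)

      det-principal-tabulate : ∀ {k} (s : Fin k → A) →
        det (principal (tabulate s)) ≈ det (λ i j → F (s i) (s j))
      det-principal-tabulate s = ≈-trans
        (≈-sym (det-reindex (≡.sym (length-tabulate s)) (principal (tabulate s))))
        (det-cong λ i j → reflexive (≡.cong₂ F (lookup-tabulate s i) (lookup-tabulate s j)))

      det-tabulate-↭ : ∀ {k} {s : Fin k → A} {xs} → tabulate s ↭ xs →
        det (λ i j → F (s i) (s j)) ≈ det (principal xs)
      det-tabulate-↭ {s = s} p = ≈-trans (≈-sym (det-principal-tabulate s)) (det-principal-↭ p)

      principal-jacobi : ∀ a b γ →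
        det (principal (a ∷ γ)) * det (principal (b ∷ γ)) +
        - 1# * (det (minor (principal (a ∷ b ∷ γ)) (suc zero) zero) *
                det (minor (principal (a ∷ b ∷ γ)) zero (suc zero))) ≈
        det (principal (a ∷ b ∷ γ)) * det (principal γ)
      principal-jacobi a b γ = ≈-trans
        (+-congʳ (*-congʳ (det-cong {M = principal (a ∷ γ)}
          {minor (principal (a ∷ b ∷ γ)) (suc zero) (suc zero)} λ where
            zero    zero    → ≈-refl
            zero    (suc j) → ≈-refl
            (suc i) zero    → ≈-refl
            (suc i) (suc j) → ≈-refl)))
        (desnanot-jacobi (principal (a ∷ b ∷ γ)))

      principal-exchange : ∀ a b γ →
        det (principal (a ∷ b ∷ γ)) ≈ 0# ⊎ det (principal γ) ≈ 0# →
        det (principal (a ∷ γ)) * det (principal (b ∷ γ)) ≈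
        det (minor (principal (a ∷ b ∷ γ)) (suc zero) zero) *
        det (minor (principal (a ∷ b ∷ γ)) zero (suc zero))
      principal-exchange a b γ vanishing = x∙y⁻¹≈ε⇒x≈y _ _ (≈-trans
        (+-congˡ (≈-sym (-1*x≈-x _)))
        (≈-trans (principal-jacobi a b γ) (product-zero vanishing)))
        where
        product-zero : ∀ {x y} → x ≈ 0# ⊎ y ≈ 0# → x * y ≈ 0#
        product-zero {x} {y} (inj₁ x≈0) = ≈-trans (*-congʳ x≈0) (zeroˡ y)
        product-zero {x} {y} (inj₂ y≈0) = ≈-trans (*-congˡ y≈0) (zeroʳ x)

-- Real and complex numbers

open +-*-Solver using (solve; _:=_; _:+_; _:*_; :-_; _:-_; con)

½*-positive : ∀ {ε} → 0ℚ ℚ.< ε → 0ℚ ℚ.< ½ ℚ.* ε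
½*-positive = ℚ.*-monoʳ-<-pos ½

½+½ : ∀ ε → ½ ℚ.* ε ℚ.+ ½ ℚ.* ε ≡ ε
½+½ = solve 1 (λ ε → con ½ :* ε :+ con ½ :* ε := ε) ≡.refl

-- `x ≈ℝ y` unfolds to `Null` of the difference of the two sequences, so each law of `_≈ℝ_` reduces
-- to a rational identity and a closure property of null sequences.
Null : (ℕ → ℚ) → Set
Null s = ∀ ε → 0ℚ ℚ.< ε → ∃ λ L → ∀ n → L ℕ.≤ n → ℚ.∣ s n ∣ ℚ.< ε

Null-resp : ∀ {s t} → (∀ n → s n ≡ t n) → Null s → Null t
Null-resp s≡t null ε 0<ε with null ε 0<ε
... | L , small = L , λ n L≤n → ≡.subst (λ q → ℚ.∣ q ∣ ℚ.< ε) (s≡t n) (small n L≤n)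

Null-0 : Null (λ _ → 0ℚ)
Null-0 ε 0<ε = 0 , λ _ _ → 0<ε

Null-neg : ∀ {s} → Null s → Null (λ n → ℚ.- s n)
Null-neg {s} null ε 0<ε with null ε 0<ε
... | L , small = L , λ n L≤n → ≡.subst (ℚ._< ε) (≡.sym (ℚ.∣-p∣≡∣p∣ (s n))) (small n L≤n)

Null-+ : ∀ {s t} → Null s → Null t → Null (λ n → s n ℚ.+ t n)
Null-+ {s} {t} nullₛ nullₜ ε 0<ε
  with nullₛ (½ ℚ.* ε) (½*-positive 0<ε) | nullₜ (½ ℚ.* ε) (½*-positive 0<ε)
... | M , smallₛ | L , smallₜ = M ℕ.⊔ L , λ n ≤n → begin-strict
  ℚ.∣ s n ℚ.+ t n ∣            ≤⟨ ℚ.∣p+q∣≤∣p∣+∣q∣ (s n) (t n) ⟩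
  ℚ.∣ s n ∣ ℚ.+ ℚ.∣ t n ∣      <⟨ ℚ.+-mono-< (smallₛ n (ℕ.m⊔n≤o⇒m≤o M L ≤n))
                                             (smallₜ n (ℕ.m⊔n≤o⇒n≤o M L ≤n)) ⟩
  ½ ℚ.* ε ℚ.+ ½ ℚ.* ε          ≡⟨ ½+½ ε ⟩
  ε                            ∎
  where open ℚ.≤-Reasoning

Null-* : ∀ (x : ℝ) {s} → Null s → Null (λ n → seq x n ℚ.* s n)
Null-* x {s} null ε 0<ε with cauchy⇒bounded (seq x) (cauchy x)
... | K , P , 0<K , bounded with null δ 0<δ
  where
  instance
    K-pos : ℚ.Positive K
    K-pos = ℚ.positive 0<K
    K-nonZero : ℚ.NonZero K
    K-nonZero = ℚ.pos⇒nonZero K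
    1/K-pos : ℚ.Positive (ℚ.1/ K)
    1/K-pos = ℚ.1/pos⇒pos K
  δ : ℚ
  δ = ℚ.1/ K ℚ.* ε
  0<δ : 0ℚ ℚ.< δ
  0<δ = ≡.subst (ℚ._< δ) (ℚ.*-zeroʳ (ℚ.1/ K)) (ℚ.*-monoʳ-<-pos (ℚ.1/ K) 0<ε)
... | L , small = P ℕ.⊔ L , λ n ≤n → begin-strict
  ℚ.∣ seq x n ℚ.* s n ∣             ≡⟨ ℚ.∣p*q∣≡∣p∣*∣q∣ (seq x n) (s n) ⟩
  ℚ.∣ seq x n ∣ ℚ.* ℚ.∣ s n ∣       ≤⟨ ℚ.*-monoʳ-≤-nonNeg ℚ.∣ s n ∣ {{ℚ.∣-∣-nonNeg (s n)}}
                                         (bounded n (ℕ.m⊔n≤o⇒m≤o P L ≤n)) ⟩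
  K ℚ.* ℚ.∣ s n ∣                   <⟨ ℚ.*-monoʳ-<-pos K (small n (ℕ.m⊔n≤o⇒n≤o P L ≤n)) ⟩
  K ℚ.* (ℚ.1/ K ℚ.* ε)              ≡⟨ ℚ.*-assoc K (ℚ.1/ K) ε ⟨
  K ℚ.* ℚ.1/ K ℚ.* ε                ≡⟨ ≡.cong (ℚ._* ε) (ℚ.*-inverseʳ K) ⟩
  1ℚ ℚ.* ε                          ≡⟨ ℚ.*-identityˡ ε ⟩
  ε                                 ∎
  where
  open ℚ.≤-Reasoning
  instance
    K-pos : ℚ.Positive K
    K-pos = ℚ.positive 0<K
    K-nonZero : ℚ.NonZero K
    K-nonZero = ℚ.pos⇒nonZero K

pointwise : ∀ {x y} → (∀ n → seq x n ≡ seq y n) → x ≈ℝ y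
pointwise {x} {y} eq = Null-resp {λ _ → 0ℚ}
  (λ n → ≡.sym (≡.trans (≡.cong (λ q → q ℚ.- seq y n) (eq n)) (ℚ.+-inverseʳ (seq y n)))) Null-0

≈ℝ-sym : ∀ {x y} → x ≈ℝ y → y ≈ℝ x
≈ℝ-sym {x} {y} x≈y = Null-resp {λ n → ℚ.- (seq x n ℚ.- seq y n)}
  (λ n → solve 2 (λ a b → :- (a :- b) := b :- a) ≡.refl (seq x n) (seq y n))
  (Null-neg {λ n → seq x n ℚ.- seq y n} x≈y)

≈ℝ-trans : ∀ {x y z} → x ≈ℝ y → y ≈ℝ z → x ≈ℝ z
≈ℝ-trans {x} {y} {z} x≈y y≈z = Null-resp {λ n → (seq x n ℚ.- seq y n) ℚ.+ (seq y n ℚ.- seq z n)}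
  (λ n → solve 3 (λ a b c → (a :- b) :+ (b :- c) := a :- c) ≡.refl (seq x n) (seq y n) (seq z n))
  (Null-+ {λ n → seq x n ℚ.- seq y n} {λ n → seq y n ℚ.- seq z n} x≈y y≈z)

+ℝ-cong : ∀ {x y u v} → x ≈ℝ y → u ≈ℝ v → x +ℝ u ≈ℝ y +ℝ v
+ℝ-cong {x} {y} {u} {v} x≈y u≈v = Null-resp {λ n → (seq x n ℚ.- seq y n) ℚ.+ (seq u n ℚ.- seq v n)}
  (λ n → solve 4 (λ a b c d → (a :- b) :+ (c :- d) := (a :+ c) :- (b :+ d)) ≡.refl
    (seq x n) (seq y n) (seq u n) (seq v n))
  (Null-+ {λ n → seq x n ℚ.- seq y n} {λ n → seq u n ℚ.- seq v n} x≈y u≈v)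

*ℝ-cong : ∀ {x y u v} → x ≈ℝ y → u ≈ℝ v → x *ℝ u ≈ℝ y *ℝ v
*ℝ-cong {x} {y} {u} {v} x≈y u≈v = Null-resp
  {λ n → seq x n ℚ.* (seq u n ℚ.- seq v n) ℚ.+ seq v n ℚ.* (seq x n ℚ.- seq y n)}
  (λ n → solve 4 (λ a b c d → a :* (c :- d) :+ d :* (a :- b) := a :* c :- b :* d) ≡.refl
    (seq x n) (seq y n) (seq u n) (seq v n))
  (Null-+ {λ n → seq x n ℚ.* (seq u n ℚ.- seq v n)} {λ n → seq v n ℚ.* (seq x n ℚ.- seq y n)}
    (Null-* x {λ n → seq u n ℚ.- seq v n} u≈v) (Null-* v {λ n → seq x n ℚ.- seq y n} x≈y))

-ℝ-cong : ∀ {x y} → x ≈ℝ y → -ℝ x ≈ℝ -ℝ y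
-ℝ-cong {x} {y} x≈y = Null-resp {λ n → ℚ.- (seq x n ℚ.- seq y n)}
  (λ n → solve 2 (λ a b → :- (a :- b) := :- a :- :- b) ≡.refl (seq x n) (seq y n))
  (Null-neg {λ n → seq x n ℚ.- seq y n} x≈y)

≈ℝ-refl : ∀ {x} → x ≈ℝ x
≈ℝ-refl {x} = pointwise {x} {x} λ n → ≡.refl

-- Signs of real numbers

p≤∣p∣ : ∀ p → p ℚ.≤ ℚ.∣ p ∣
p≤∣p∣ p with ℚ.≤-total 0ℚ p
... | inj₁ 0≤p = ℚ.≤-reflexive (≡.sym (ℚ.0≤p⇒∣p∣≡p 0≤p))
... | inj₂ p≤0 = ℚ.≤-trans p≤0 (ℚ.0≤∣p∣ p)

-- Spreads a positive gap from one rational to its neighbours, giving up half of it: along `_≈ℝ_`,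
-- and from one term of a Cauchy sequence to all later ones.
½ε<nearby : ∀ {ε a b} → ε ℚ.≤ a → ℚ.∣ a ℚ.- b ∣ ℚ.< ½ ℚ.* ε → ½ ℚ.* ε ℚ.< b
½ε<nearby {ε} {a} {b} ε≤a near = begin-strict
  ½ ℚ.* ε                       ≡⟨ solve 1 (λ ε → con ½ :* ε := ε :- con ½ :* ε) ≡.refl ε ⟩
  ε ℚ.- ½ ℚ.* ε                 <⟨ ℚ.+-mono-≤-< ε≤a (ℚ.neg-antimono-< near) ⟩
  a ℚ.- ℚ.∣ a ℚ.- b ∣           ≤⟨ ℚ.+-monoʳ-≤ a (ℚ.neg-antimono-≤ (p≤∣p∣ (a ℚ.- b))) ⟩
  a ℚ.- (a ℚ.- b)               ≡⟨ solve 2 (λ a b → a :- (a :- b) := b) ≡.refl a b ⟩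
  b                             ∎
  where open ℚ.≤-Reasoning

eventually>⇒0<ℝ : ∀ (x : ℝ) ε → 0ℚ ℚ.< ε → (∃ λ L → ∀ n → L ℕ.≤ n → ε ℚ.< seq x n) → 0ℝ <ℝ x
eventually>⇒0<ℝ x ε 0<ε (L , above) = ε , 0<ε , L , λ n L≤n →
  ≡.subst (ℚ._< seq x n) (≡.sym (ℚ.+-identityˡ ε)) (above n L≤n)

0<ℝ-resp-≈ℝ : ∀ {x y} → x ≈ℝ y → 0ℝ <ℝ x → 0ℝ <ℝ y
0<ℝ-resp-≈ℝ {x} {y} x≈y (ε , 0<ε , M , above) with x≈y (½ ℚ.* ε) (½*-positive 0<ε)
... | L , near = eventually>⇒0<ℝ y (½ ℚ.* ε) (½*-positive 0<ε) (M ℕ.⊔ L , λ n ≤n →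
  ½ε<nearby (ℚ.<⇒≤ (≡.subst (ℚ._< seq x n) (ℚ.+-identityˡ ε) (above n (ℕ.m⊔n≤o⇒m≤o M L ≤n))))
    (near n (ℕ.m⊔n≤o⇒n≤o M L ≤n)))

0<-x⇒x<0 : ∀ {x} → 0ℝ <ℝ -ℝ x → x <ℝ 0ℝ
0<-x⇒x<0 {x} (ε , 0<ε , L , above) = ε , 0<ε , L , λ n L≤n → begin-strict
  seq x n ℚ.+ ε                      ≡⟨ solve 2 (λ a e → a :+ e := a :+ (con 0ℚ :+ e)) ≡.refl (seq x n) ε ⟩
  seq x n ℚ.+ (0ℚ ℚ.+ ε)             <⟨ ℚ.+-monoʳ-< (seq x n) (above n L≤n) ⟩
  seq x n ℚ.- seq x n                ≡⟨ ℚ.+-inverseʳ (seq x n) ⟩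
  0ℚ                                 ∎
  where open ℚ.≤-Reasoning

-- For a single rational term it is decidable whether it lies within `ε` of 0. If a term past the
-- Cauchy threshold for `½ ℚ.* ε` does not, all later terms keep its sign with gap `½ ℚ.* ε`, and
-- `x` is positive or negative after all.
≈0-from-≯-≮ : ∀ {x} → ¬ 0ℝ <ℝ x → ¬ x <ℝ 0ℝ → x ≈ℝ 0ℝ
≈0-from-≯-≮ {x} ≯0 ≮0 ε 0<ε with cauchy x (½ ℚ.* ε) (½*-positive 0<ε)
... | L , near = L , λ n L≤n → small n L≤n
  where
  neg-near : ∀ {ε} a b → ℚ.∣ a ℚ.- b ∣ ℚ.< ε → ℚ.∣ ℚ.- a ℚ.- ℚ.- b ∣ ℚ.< ε
  neg-near {ε} a b = ≡.subst (ℚ._< ε) (≡.trans (≡.sym (ℚ.∣-p∣≡∣p∣ (a ℚ.- b)))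
    (≡.cong ℚ.∣_∣ (solve 2 (λ a b → :- (a :- b) := :- a :- :- b) ≡.refl a b)))

  small : ∀ n → L ℕ.≤ n → ℚ.∣ seq x n ℚ.- 0ℚ ∣ ℚ.< ε
  small n L≤n with ℚ.∣ seq x n ℚ.- 0ℚ ∣ ℚ.<? ε
  ... | yes <ε = <ε
  ... | no ≮ε with ℚ.∣p∣≡p∨∣p∣≡-p (seq x n)
     | ≡.subst (λ q → ε ℚ.≤ ℚ.∣ q ∣) (ℚ.+-identityʳ (seq x n)) (ℚ.≮⇒≥ ≮ε)
  ...   | inj₁ eq | ε≤∣x∣ = ⊥-elim (≯0 (eventually>⇒0<ℝ x (½ ℚ.* ε) (½*-positive 0<ε)
    (n , λ m n≤m → ½ε<nearby (≡.subst (ε ℚ.≤_) eq ε≤∣x∣)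
      (near n m L≤n (ℕ.≤-trans L≤n n≤m)))))
  ...   | inj₂ eq | ε≤∣x∣ = ⊥-elim (≮0 (0<-x⇒x<0 {x}
    (eventually>⇒0<ℝ (-ℝ x) (½ ℚ.* ε) (½*-positive 0<ε)
      (n , λ m n≤m → ½ε<nearby (≡.subst (ε ℚ.≤_) eq ε≤∣x∣)
        (neg-near (seq x n) (seq x m) (near n m L≤n (ℕ.≤-trans L≤n n≤m)))))))

0≤p*p : ∀ p → 0ℚ ℚ.≤ p ℚ.* p
0≤p*p p with ℚ.≤-total 0ℚ p
... | inj₁ 0≤p = ≡.subst (ℚ._≤ p ℚ.* p) (ℚ.*-zeroˡ p)
  (ℚ.*-monoʳ-≤-nonNeg p {{ℚ.nonNegative 0≤p}} 0≤p)
... | inj₂ p≤0 = ≡.subst (ℚ._≤ p ℚ.* p) (ℚ.*-zeroˡ p)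
  (ℚ.*-monoʳ-≤-nonPos p {{ℚ.nonPositive p≤0}} p≤0)

-- The gaps eventually put the product below `- (ε * δ)`, while the sum of squares is nonnegative at
-- every index. Testing the equality with tolerance `ε * δ` gives a contradiction at one index past
-- all three thresholds.
pos*neg≉sum-of-squares : ∀ {x y} u v → 0ℝ <ℝ x → y <ℝ 0ℝ → ¬ x *ℝ y ≈ℝ u *ℝ u +ℝ v *ℝ v
pos*neg≉sum-of-squares {x} {y} u v (ε , 0<ε , K , above) (δ , 0<δ , L , below) xy≈uu+vv =
  ℚ.<-irrefl ≡.refl (begin-strict
    ε ℚ.* δ                     ≤⟨ ℚ.*-monoʳ-≤-nonNeg δ {{ℚ.nonNegative (ℚ.<⇒≤ 0<δ)}} (ℚ.<⇒≤ ε<a) ⟩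
    a ℚ.* δ                     <⟨ ℚ.*-monoʳ-<-pos a {{ℚ.positive (ℚ.<-trans 0<ε ε<a)}} δ<-b ⟩
    a ℚ.* (ℚ.- b)               ≡⟨ solve 2 (λ a b → a :* (:- b) := con 0ℚ :+ con 0ℚ :- a :* b) ≡.refl a b ⟩
    0ℚ ℚ.+ 0ℚ ℚ.- a ℚ.* b       ≤⟨ ℚ.+-monoˡ-≤ (ℚ.- (a ℚ.* b)) (ℚ.+-mono-≤ (0≤p*p (seq u n)) (0≤p*p (seq v n))) ⟩
    s ℚ.- a ℚ.* b               ≤⟨ p≤∣p∣ (s ℚ.- a ℚ.* b) ⟩
    ℚ.∣ s ℚ.- a ℚ.* b ∣         ≡⟨ ℚ.∣-p∣≡∣p∣ (s ℚ.- a ℚ.* b) ⟨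
    ℚ.∣ ℚ.- (s ℚ.- a ℚ.* b) ∣   ≡⟨ ≡.cong ℚ.∣_∣ (solve 2 (λ s t → :- (s :- t) := t :- s) ≡.refl s (a ℚ.* b)) ⟩
    ℚ.∣ a ℚ.* b ℚ.- s ∣         <⟨ proj₂ close n (ℕ.m≤n⊔m (K ℕ.⊔ L) (proj₁ close)) ⟩
    ε ℚ.* δ                     ∎)
  where
  open ℚ.≤-Reasoning

  0<εδ : 0ℚ ℚ.< ε ℚ.* δ
  0<εδ = ≡.subst (ℚ._< ε ℚ.* δ) (ℚ.*-zeroʳ ε) (ℚ.*-monoʳ-<-pos ε {{ℚ.positive 0<ε}} 0<δ)

  close : ∃ λ M → ∀ n → M ℕ.≤ n →
    ℚ.∣ seq x n ℚ.* seq y n ℚ.- (seq u n ℚ.* seq u n ℚ.+ seq v n ℚ.* seq v n) ∣ ℚ.< ε ℚ.* δ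
  close = xy≈uu+vv (ε ℚ.* δ) 0<εδ

  n : ℕ
  n = (K ℕ.⊔ L) ℕ.⊔ proj₁ close

  a b s : ℚ
  a = seq x n
  b = seq y n
  s = seq u n ℚ.* seq u n ℚ.+ seq v n ℚ.* seq v n

  ε<a : ε ℚ.< a
  ε<a = ≡.subst (ℚ._< a) (ℚ.+-identityˡ ε)
    (above n (ℕ.≤-trans (ℕ.m≤m⊔n K L) (ℕ.m≤m⊔n (K ℕ.⊔ L) (proj₁ close))))

  δ<-b : δ ℚ.< ℚ.- b
  δ<-b = begin-strict
    δ                     ≡⟨ solve 2 (λ b d → d := :- b :+ (b :+ d)) ≡.refl b δ ⟩
    ℚ.- b ℚ.+ (b ℚ.+ δ)   <⟨ ℚ.+-monoʳ-< (ℚ.- b) (below n (ℕ.≤-trans (ℕ.m≤n⊔m K L) (ℕ.m≤m⊔n (K ℕ.⊔ L) (proj₁ close)))) ⟩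
    ℚ.- b ℚ.+ 0ℚ          ≡⟨ ℚ.+-identityʳ (ℚ.- b) ⟩
    ℚ.- b                 ∎

-- Otherwise `x *ℝ x` would be at once a positive times a negative number and the sum of squares
-- with `u = x` and `v = 0`.
0<ℝ-asym : ∀ {x} → 0ℝ <ℝ x → ¬ x <ℝ 0ℝ
0<ℝ-asym {x} 0<x x<0 = pos*neg≉sum-of-squares {x} {x} x 0ℝ 0<x x<0
  (pointwise {x *ℝ x} {x *ℝ x +ℝ 0ℝ *ℝ 0ℝ} λ n →
    solve 1 (λ a → a := a :+ con 0ℚ :* con 0ℚ) ≡.refl (seq x n ℚ.* seq x n))

-- The operations act termwise, so the ring laws of `ℂ` already hold as rational identities at each
-- index; only the congruences involve limits.
pointwiseℂ : ∀ {z w} → (∀ n → seq (re z) n ≡ seq (re w) n) →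
  (∀ n → seq (im z) n ≡ seq (im w) n) → z ≈ℂ w
pointwiseℂ {z} {w} eqʳ eqⁱ = pointwise {re z} {re w} eqʳ , pointwise {im z} {im w} eqⁱ

*ℂ-cong : ∀ {z w t s} → z ≈ℂ w → t ≈ℂ s → z *ℂ t ≈ℂ w *ℂ s
*ℂ-cong {z} {w} {t} {s} (zw , zw′) (ts , ts′) =
  +ℝ-cong {re z *ℝ re t} {re w *ℝ re s} { -ℝ (im z *ℝ im t)} { -ℝ (im w *ℝ im s)}
    (*ℝ-cong {re z} {re w} {re t} {re s} zw ts)
    (-ℝ-cong {im z *ℝ im t} {im w *ℝ im s} (*ℝ-cong {im z} {im w} {im t} {im s} zw′ ts′)) ,
  +ℝ-cong {re z *ℝ im t} {re w *ℝ im s} {im z *ℝ re t} {im w *ℝ re s}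
    (*ℝ-cong {re z} {re w} {im t} {im s} zw ts′)
    (*ℝ-cong {im z} {im w} {re t} {re s} zw′ ts)

*ℂ-comm : ∀ z w → z *ℂ w ≈ℂ w *ℂ z
*ℂ-comm z w = pointwiseℂ {z *ℂ w} {w *ℂ z}
  (λ n → solve 4 (λ a b c d → a :* c :+ :- (b :* d) := c :* a :+ :- (d :* b)) ≡.refl
    (seq (re z) n) (seq (im z) n) (seq (re w) n) (seq (im w) n))
  (λ n → solve 4 (λ a b c d → a :* d :+ b :* c := c :* b :+ d :* a) ≡.refl
    (seq (re z) n) (seq (im z) n) (seq (re w) n) (seq (im w) n))

*ℂ-assoc : ∀ z w t → (z *ℂ w) *ℂ t ≈ℂ z *ℂ (w *ℂ t)
*ℂ-assoc z w t = pointwiseℂ {(z *ℂ w) *ℂ t} {z *ℂ (w *ℂ t)}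
  (λ n → solve 6 (λ a b c d e f →
      (a :* c :+ :- (b :* d)) :* e :+ :- ((a :* d :+ b :* c) :* f) :=
      a :* (c :* e :+ :- (d :* f)) :+ :- (b :* (c :* f :+ d :* e))) ≡.refl
    (seq (re z) n) (seq (im z) n) (seq (re w) n) (seq (im w) n) (seq (re t) n) (seq (im t) n))
  (λ n → solve 6 (λ a b c d e f →
      (a :* c :+ :- (b :* d)) :* f :+ (a :* d :+ b :* c) :* e :=
      a :* (c :* f :+ d :* e) :+ b :* (c :* e :+ :- (d :* f))) ≡.refl
    (seq (re z) n) (seq (im z) n) (seq (re w) n) (seq (im w) n) (seq (re t) n) (seq (im t) n))

*ℂ-identityˡ : ∀ z → 1ℂ *ℂ z ≈ℂ z
*ℂ-identityˡ z = pointwiseℂ {1ℂ *ℂ z} {z}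
  (λ n → solve 2 (λ a b → con 1ℚ :* a :+ :- (con 0ℚ :* b) := a) ≡.refl (seq (re z) n) (seq (im z) n))
  (λ n → solve 2 (λ a b → con 1ℚ :* b :+ con 0ℚ :* a := b) ≡.refl (seq (re z) n) (seq (im z) n))

*ℂ-distribˡ-+ℂ : ∀ z w t → z *ℂ (w +ℂ t) ≈ℂ z *ℂ w +ℂ z *ℂ t
*ℂ-distribˡ-+ℂ z w t = pointwiseℂ {z *ℂ (w +ℂ t)} {z *ℂ w +ℂ z *ℂ t}
  (λ n → solve 6 (λ a b c d e f →
      a :* (c :+ e) :+ :- (b :* (d :+ f)) :=
      (a :* c :+ :- (b :* d)) :+ (a :* e :+ :- (b :* f))) ≡.refl
    (seq (re z) n) (seq (im z) n) (seq (re w) n) (seq (im w) n) (seq (re t) n) (seq (im t) n))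
  (λ n → solve 6 (λ a b c d e f →
      a :* (d :+ f) :+ b :* (c :+ e) :=
      (a :* d :+ b :* c) :+ (a :* f :+ b :* e)) ≡.refl
    (seq (re z) n) (seq (im z) n) (seq (re w) n) (seq (im w) n) (seq (re t) n) (seq (im t) n))

≈ℂ-trans : ∀ {z w t} → z ≈ℂ w → w ≈ℂ t → z ≈ℂ t
≈ℂ-trans {z} {w} {t} (p , p′) (q , q′) =
  ≈ℝ-trans {re z} {re w} {re t} p q , ≈ℝ-trans {im z} {im w} {im t} p′ q′

+ℂ-comm : ∀ z w → z +ℂ w ≈ℂ w +ℂ z
+ℂ-comm z w = pointwiseℂ {z +ℂ w} {w +ℂ z} (λ n → ℚ.+-comm (seq (re z) n) _) (λ n → ℚ.+-comm (seq (im z) n) _)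

ℂ-commutativeRing : CommutativeRing 0ℓ 0ℓ
ℂ-commutativeRing = record
  { Carrier = ℂ
  ; _≈_     = _≈ℂ_
  ; _+_     = _+ℂ_
  ; _*_     = _*ℂ_
  ; -_      = -ℂ_
  ; 0#      = 0ℂ
  ; 1#      = 1ℂ
  ; isCommutativeRing = record
    { isRing = record
      { +-isAbelianGroup = record
        { isGroup = record
          { isMonoid = record
            { isSemigroup = record
              { isMagma = record
                { isEquivalence = record
                  { refl  = λ {z} → pointwiseℂ {z} {z} (λ _ → ≡.refl) (λ _ → ≡.refl)
                  ; sym   = λ {z} {w} (p , q) → ≈ℝ-sym {re z} {re w} p , ≈ℝ-sym {im z} {im w} q
                  ; trans = λ {z} {w} {t} → ≈ℂ-trans {z} {w} {t}
                  }
                ; ∙-cong = λ {z} {w} {t} {s} (p , p′) (q , q′) →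
                    +ℝ-cong {re z} {re w} {re t} {re s} p q ,
                    +ℝ-cong {im z} {im w} {im t} {im s} p′ q′
                }
              ; assoc = λ z w t → pointwiseℂ {(z +ℂ w) +ℂ t} {z +ℂ (w +ℂ t)}
                  (λ n → ℚ.+-assoc (seq (re z) n) _ _) (λ n → ℚ.+-assoc (seq (im z) n) _ _)
              }
            ; identity =
                (λ z → pointwiseℂ {0ℂ +ℂ z} {z} (λ n → ℚ.+-identityˡ _) (λ n → ℚ.+-identityˡ _)) ,
                (λ z → pointwiseℂ {z +ℂ 0ℂ} {z} (λ n → ℚ.+-identityʳ _) (λ n → ℚ.+-identityʳ _))
            }
          ; inverse =
              (λ z → pointwiseℂ { -ℂ z +ℂ z} {0ℂ} (λ n → ℚ.+-inverseˡ (seq (re z) n)) (λ n → ℚ.+-inverseˡ (seq (im z) n))) ,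
              (λ z → pointwiseℂ {z +ℂ -ℂ z} {0ℂ} (λ n → ℚ.+-inverseʳ (seq (re z) n)) (λ n → ℚ.+-inverseʳ (seq (im z) n)))
          ; ⁻¹-cong = λ {z} {w} (p , q) → -ℝ-cong {re z} {re w} p , -ℝ-cong {im z} {im w} q
          }
        ; comm = +ℂ-comm
        }
      ; *-cong     = λ {z} {w} {t} {s} → *ℂ-cong {z} {w} {t} {s}
      ; *-assoc    = *ℂ-assoc
      ; *-identity = *ℂ-identityˡ ,
          λ z → ≈ℂ-trans {z *ℂ 1ℂ} {1ℂ *ℂ z} {z} (*ℂ-comm z 1ℂ) (*ℂ-identityˡ z)
      ; distrib    = *ℂ-distribˡ-+ℂ , distribʳ
      }
    ; *-comm = *ℂ-comm
    }
  }
  where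
  distribʳ : ∀ z w t → (w +ℂ t) *ℂ z ≈ℂ w *ℂ z +ℂ t *ℂ z
  distribʳ z w t = pointwiseℂ {(w +ℂ t) *ℂ z} {w *ℂ z +ℂ t *ℂ z}
    (λ n → solve 6 (λ a b c d e f →
        (c :+ e) :* a :+ :- ((d :+ f) :* b) :=
        (c :* a :+ :- (d :* b)) :+ (e :* a :+ :- (f :* b))) ≡.refl
      (seq (re z) n) (seq (im z) n) (seq (re w) n) (seq (im w) n) (seq (re t) n) (seq (im t) n))
    (λ n → solve 6 (λ a b c d e f →
        (c :+ e) :* b :+ (d :+ f) :* a :=
        (c :* b :+ d :* a) :+ (e :* b :+ f :* a)) ≡.refl
      (seq (re z) n) (seq (im z) n) (seq (re w) n) (seq (im w) n) (seq (re t) n) (seq (im t) n))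

≈ℂ-refl : ∀ {z} → z ≈ℂ z
≈ℂ-refl {z} = CommutativeRing.refl ℂ-commutativeRing {z}

≈ℂ-sym : ∀ {z w} → z ≈ℂ w → w ≈ℂ z
≈ℂ-sym {z} {w} = CommutativeRing.sym ℂ-commutativeRing {z} {w}

conj-isRingHomomorphism : RingMorphisms.IsRingHomomorphism ℂ-rawRing ℂ-rawRing conj
conj-isRingHomomorphism = record
  { isSemiringHomomorphism = record
    { isNearSemiringHomomorphism = record
      { +-isMonoidHomomorphism = record
        { isMagmaHomomorphism = record
          { isRelHomomorphism = record
            { cong = λ {z} {w} (p , q) → p , -ℝ-cong {im z} {im w} q }
          ; homo = λ z w → pointwiseℂ {conj (z +ℂ w)} {conj z +ℂ conj w}
              (λ n → ≡.refl) (λ n → ℚ.neg-distrib-+ (seq (im z) n) (seq (im w) n))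
          }
        ; ε-homo = pointwiseℂ {conj 0ℂ} {0ℂ} (λ _ → ≡.refl) (λ _ → ≡.refl)
        }
      ; *-homo = λ z w → pointwiseℂ {conj (z *ℂ w)} {conj z *ℂ conj w}
          (λ n → solve 4 (λ a b c d → a :* c :+ :- (b :* d) := a :* c :+ :- (:- b :* :- d)) ≡.refl
            (seq (re z) n) (seq (im z) n) (seq (re w) n) (seq (im w) n))
          (λ n → solve 4 (λ a b c d → :- (a :* d :+ b :* c) := a :* :- d :+ :- b :* c) ≡.refl
            (seq (re z) n) (seq (im z) n) (seq (re w) n) (seq (im w) n))
      }
    ; 1#-homo = pointwiseℂ {conj 1ℂ} {1ℂ} (λ _ → ≡.refl) (λ _ → ≡.refl)
    }
  ; -‿homo = λ z → pointwiseℂ {conj (-ℂ z)} { -ℂ conj z} (λ _ → ≡.refl) (λ _ → ≡.refl)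
  }

-- Lists of distinct indices and minors

open Determinant ℂ-rawRing using (det)
open DeterminantProperties ℂ-commutativeRing
  using ( minor; det-adjoint; principal; principal-exchange
        ; det-principal-↭; det-tabulate-↭ )

Unique-resp-↭ : ∀ {A : Set} {xs ys : List A} → xs ↭ ys → Unique xs → Unique ys
Unique-resp-↭ p = SetoidPermutation.Unique-resp-↭ (≡.setoid _) (↭⇒↭ₛ p)

elements : ∀ {n} → Subset n → List (Fin n)
elements α = tabulate (element α)

element-injective : ∀ {n} (α : Subset n) {i j} → element α i ≡ element α j → i ≡ j
element-injective (inside  ∷ α) {zero}  {zero}  eq = ≡.refl
element-injective (inside  ∷ α) {suc i} {suc j} eq = ≡.cong suc (element-injective α (suc-injective eq))
element-injective (outside ∷ α) eq = element-injective α (suc-injective eq)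

elements-outside : ∀ {n} (α : Subset n) → elements (outside ∷ α) ≡ map suc (elements α)
elements-outside α = ≡.sym (map-tabulate (element α) suc)

elements-inside : ∀ {n} (α : Subset n) → elements (inside ∷ α) ≡ zero ∷ map suc (elements α)
elements-inside α = ≡.cong (zero ∷_) (≡.sym (map-tabulate (element α) suc))

elements-insert : ∀ {n} (α : Subset n) x → x ∉ elements α →
  elements (α [ x ]≔ inside) ↭ x ∷ elements α
elements-insert (inside ∷ α) zero x∉ = ⊥-elim (x∉ (here ≡.refl))
elements-insert (outside ∷ α) zero x∉ = refl
elements-insert (inside ∷ α) (suc x) x∉
  rewrite elements-inside (α [ x ]≔ inside) | elements-inside α =
  trans (prep zero (map⁺ suc (elements-insert α x λ x∈ → x∉ (there (∈-map⁺ suc x∈)))))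
    (swap zero (suc x) refl)
elements-insert (outside ∷ α) (suc x) x∉
  rewrite elements-outside (α [ x ]≔ inside) | elements-outside α =
  map⁺ suc (elements-insert α x λ x∈ → x∉ (∈-map⁺ suc x∈))

elements-∅ : ∀ n → elements (Vec.replicate n outside) ≡ []
elements-∅ zero    = ≡.refl
elements-∅ (suc n) = ≡.trans (elements-outside (Vec.replicate n outside))
  (≡.cong (map suc) (elements-∅ n))

-- Lets hypotheses about all subsets be applied to lists. The subset arises by inserting the entries
-- into the empty one.
unique⇒elements : ∀ {n} {xs : List (Fin n)} → Unique xs → ∃ λ α → elements α ↭ xs
unique⇒elements {n} {[]} _ = Vec.replicate n outside , ↭-reflexive (elements-∅ n)
unique⇒elements {n} {x ∷ xs} unique@(_ ∷ unique′) with unique⇒elements unique′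
... | α , p = α [ x ]≔ inside , ↭-trans
  (elements-insert α x λ x∈ → Unique[x∷xs]⇒x∉xs unique (∈-resp-↭ p x∈)) (prep x p)

-- Chains of exchanges between index lists

module _ {n} {P : List (Fin n) → Set} {m : ℕ}
  (P-resp-↭ : ∀ {xs ys} → xs ↭ ys → P xs → P ys)
  (P-exchange : ∀ a b γ → Unique (a ∷ b ∷ γ) → length γ ≡ m → P (a ∷ γ) → ¬ ¬ P (b ∷ γ))
  where

  -- Replaces the entries of xs by those of ys one by one; zs collects the
  -- entries that are already in place.
  exchange-walk : ∀ xs ys zs → length xs ≡ length ys → length (ys ++ zs) ≡ suc m →
    Unique (xs ++ zs) → Unique (ys ++ zs) → P (xs ++ zs) → ¬ ¬ P (ys ++ zs)
  exchange-walk []       []       zs _ _ _ _ pos ¬pos = ¬pos pos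
  exchange-walk (a ∷ xs) (b ∷ ys) zs len total uniqueˣ uniqueʸ@(b∉ ∷ _) pos ¬pos with _∈?_ _≟_ b (a ∷ xs)
  -- `b` is already present, so it moves over to `zs` by a permutation, without an exchange.
  ... | yes b∈ with ∈-∃++ b∈
  ...   | ps , qs , eq = continue (ps ++ qs)
    (ℕ.suc-injective (≡.trans (≡.sym (↭-length (shift b ps qs)))
      (≡.trans (≡.cong length (≡.sym eq)) len)))
    (Unique-resp-↭ p uniqueˣ) (P-resp-↭ p pos) ¬pos
    where
    p : (a ∷ xs) ++ zs ↭ (ps ++ qs) ++ b ∷ zs
    p = ↭-trans (++⁺ʳ zs (↭-trans (↭-reflexive eq) (shift b ps qs))) (↭-sym (shift b (ps ++ qs) zs))

    continue : ∀ ws → length ws ≡ length ys → Unique (ws ++ b ∷ zs) →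
      P (ws ++ b ∷ zs) → ¬ ¬ P (b ∷ ys ++ zs)
    continue ws len′ unique pos ¬pos = exchange-walk ws ys (b ∷ zs) len′
      (≡.trans (↭-length (shift b ys zs)) total) unique
      (Unique-resp-↭ (↭-sym (shift b ys zs)) uniqueʸ) pos
      λ pos′ → ¬pos (P-resp-↭ (shift b ys zs) pos′)
  -- `b` is new and replaces `a`. It is absent from `xs` by the test and from `zs` because the
  -- target list has no repetitions, so the exchange runs over `xs ++ zs`.
  exchange-walk (a ∷ xs) (b ∷ ys) zs len total (a∉ ∷ uniqueˣ) uniqueʸ@(b∉ ∷ _) pos ¬pos | no b∉axs
    with ¬Any⇒All¬ (a ∷ xs) b∉axs
  ...   | b≢a ∷ b∉xs = P-exchange a b (xs ++ zs)
    (((λ a≡b → b≢a (≡.sym a≡b)) ∷ a∉) ∷ unique-b) len-γ pos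
    λ pos′ → exchange-walk xs ys (b ∷ zs) (ℕ.suc-injective len)
      (≡.trans (↭-length (shift b ys zs)) total)
      (Unique-resp-↭ (↭-sym (shift b xs zs)) unique-b)
      (Unique-resp-↭ (↭-sym (shift b ys zs)) uniqueʸ)
      (P-resp-↭ (↭-sym (shift b xs zs)) pos′)
      λ pos″ → ¬pos (P-resp-↭ (shift b ys zs) pos″)
    where
    unique-b : Unique (b ∷ xs ++ zs)
    unique-b = All-++⁺ b∉xs (++⁻ʳ ys b∉) ∷ uniqueˣ

    len-γ : length (xs ++ zs) ≡ m
    len-γ = ℕ.suc-injective (≡.trans (≡.cong suc
      (≡.trans (length-++ xs) (≡.trans
        (≡.cong (ℕ._+ length zs) (ℕ.suc-injective len)) (≡.sym (length-++ ys))))) total)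

all-minors⇒lists : ∀ {n} (B : Matrix ℂ n) (P : ℂ → Set) →
  (∀ z w → z ≈ℂ w → P z → P w) → ∀ {k} → AllMinors B k P →
  ∀ xs → Unique xs → length xs ≡ k → P (det (principal B xs))
all-minors⇒lists B P resp all xs unique len with unique⇒elements unique
... | α , p = resp (principalMinor B α) (det (principal B xs)) (det-tabulate-↭ B {s = element α} p)
  (all α (≡.trans (≡.sym (length-tabulate (element α))) (≡.trans (↭-length p) len)))

-- Signs of the minors of a Hermitian matrix

≈conj⇒real : ∀ {z} → z ≈ℂ conj z → im z ≈ℝ 0ℝ
≈conj⇒real {z} (_ , p) = Null-resp
  {λ n → ½ ℚ.* (seq (im z) n ℚ.- ℚ.- seq (im z) n)}
  (λ n → solve 1 (λ a → con ½ :* (a :- :- a) := a :- con 0ℚ) ≡.refl (seq (im z) n))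
  (Null-* (fromℚ ½) {λ n → seq (im z) n ℚ.- ℚ.- seq (im z) n} p)

real-product : ∀ {x y z w} → im x ≈ℝ 0ℝ → im y ≈ℝ 0ℝ → w ≈ℂ conj z → x *ℂ y ≈ℂ z *ℂ w →
  re x *ℝ re y ≈ℝ re z *ℝ re z +ℝ im z *ℝ im z
real-product {x} {y} {z} {w} x-real y-real w≈z̄ (xy≈zw , _) =
  ≈ℝ-trans {re x *ℝ re y} {re x *ℝ re y +ℝ -ℝ (0ℝ *ℝ 0ℝ)} {norm}
    (pointwise {re x *ℝ re y} {re x *ℝ re y +ℝ -ℝ (0ℝ *ℝ 0ℝ)} λ n →
      solve 1 (λ a → a := a :+ :- (con 0ℚ :* con 0ℚ)) ≡.refl (seq (re x) n ℚ.* seq (re y) n))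
  (≈ℝ-trans {re x *ℝ re y +ℝ -ℝ (0ℝ *ℝ 0ℝ)} {re (x *ℂ y)} {norm}
    (+ℝ-cong {re x *ℝ re y} {re x *ℝ re y} { -ℝ (0ℝ *ℝ 0ℝ)} { -ℝ (im x *ℝ im y)}
      (≈ℝ-refl {re x *ℝ re y})
      (-ℝ-cong {0ℝ *ℝ 0ℝ} {im x *ℝ im y}
        (≈ℝ-sym {im x *ℝ im y} {0ℝ *ℝ 0ℝ} (*ℝ-cong {im x} {0ℝ} {im y} {0ℝ} x-real y-real))))
  (≈ℝ-trans {re (x *ℂ y)} {re (z *ℂ w)} {norm} xy≈zw
  (≈ℝ-trans {re (z *ℂ w)} {re (z *ℂ conj z)} {norm}
    (proj₁ (*ℂ-cong {z} {z} {w} {conj z} (≈ℂ-refl {z}) w≈z̄))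
    (pointwise {re (z *ℂ conj z)} {norm} λ n →
      solve 2 (λ a b → a :* a :+ :- (b :* :- b) := a :* a :+ b :* b) ≡.refl (seq (re z) n) (seq (im z) n)))))
  where
  norm : ℝ
  norm = re z *ℝ re z +ℝ im z *ℝ im z

module _ {n} (B : Matrix ℂ n) (hermitian : Hermitian B) where

  private
    δ : List (Fin n) → ℂ
    δ xs = det (principal B xs)

  -- A principal submatrix is its own conjugate transpose, so its determinant is its own conjugate.
  minor-real : ∀ xs → im (δ xs) ≈ℝ 0ℝ
  minor-real xs = ≈conj⇒real {δ xs} (det-adjoint {conj} conj-isRingHomomorphism (principal B xs) (principal B xs)
    λ i j → hermitian (lookup xs i) (lookup xs j))

  exchange-sum-of-squares : ∀ a b γ → Zero (δ (a ∷ b ∷ γ)) ⊎ Zero (δ γ) →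
    ∃₂ λ u v → re (δ (a ∷ γ)) *ℝ re (δ (b ∷ γ)) ≈ℝ u *ℝ u +ℝ v *ℝ v
  exchange-sum-of-squares a b γ vanishing =
    re z , im z , real-product {δ (a ∷ γ)} {δ (b ∷ γ)} {z} {w}
      (minor-real (a ∷ γ)) (minor-real (b ∷ γ))
      -- Deleting row 0 and column 1 gives the conjugate transpose of deleting row 1 and column 0.
      (det-adjoint {conj} conj-isRingHomomorphism
        (minor M zero (suc zero)) (minor M (suc zero) zero) λ i j → hermitian _ _)
      (principal-exchange B a b γ vanishing)
    where
    M : Matrix ℂ (suc (suc (length γ)))
    M = principal B (a ∷ b ∷ γ)

    z w : ℂ
    z = det (minor M (suc zero) zero)
    w = det (minor M zero (suc zero))

  module _ (m : ℕ)
    (nonzero : ∀ xs → Unique xs → length xs ≡ suc m → Nonzero (δ xs))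
    (vanishing : ∀ a b γ → Unique (a ∷ b ∷ γ) → length γ ≡ m →
      Zero (δ (a ∷ b ∷ γ)) ⊎ Zero (δ γ))
    where

    IsPositive : List (Fin n) → Set
    IsPositive xs = 0ℝ <ℝ re (δ xs)

    IsPositive-resp-↭ : ∀ {xs ys} → xs ↭ ys → IsPositive xs → IsPositive ys
    IsPositive-resp-↭ {xs} {ys} p = 0<ℝ-resp-≈ℝ {re (δ xs)} {re (δ ys)} (proj₁ (det-principal-↭ B p))

    -- If the second minor is not positive, it is neither positive nor negative, the latter because
    -- the product is a sum of squares. Its real part is then 0, and as it is real it vanishes,
    -- against `nonzero`.
    exchange-positive : ∀ a b γ → Unique (a ∷ b ∷ γ) → length γ ≡ m →
      IsPositive (a ∷ γ) → ¬ ¬ IsPositive (b ∷ γ)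
    exchange-positive a b γ unique@(_ ∷ unique-bγ) len a>0 ¬b>0 =
      let u , v , squares = exchange-sum-of-squares a b γ (vanishing a b γ unique len)
      in nonzero (b ∷ γ) unique-bγ (≡.cong suc len)
        (≈0-from-≯-≮ {re (δ (b ∷ γ))} ¬b>0
          (λ b<0 → pos*neg≉sum-of-squares {re (δ (a ∷ γ))} {re (δ (b ∷ γ))} u v a>0 b<0 squares)
        , minor-real (b ∷ γ))

    no-opposite-minors : SomeMinor B (suc m) Positive → SomeMinor B (suc m) Negative → ⊥
    no-opposite-minors (α , ∣α∣ , _ , α>0) (β , ∣β∣ , _ , β<0) =
      -- The doubly negated conclusion is enough, since it is applied to the refutation of
      -- positivity that the negative minor at `β` supplies.
      exchange-walk {P = IsPositive} IsPositive-resp-↭ exchange-positive (elements α) (elements β) []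
        (≡.trans (len α ∣α∣) (≡.sym (len β ∣β∣)))
        (≡.trans (↭-length (++-[] (elements β))) (len β ∣β∣))
        (unique α) (unique β)
        (IsPositive-resp-↭ (↭-sym (++-[] (elements α)))
          (0<ℝ-resp-≈ℝ {re (principalMinor B α)} {re (δ (elements α))}
            (proj₁ (det-tabulate-↭ B {s = element α} refl)) α>0))
        λ pos → 0<ℝ-asym {re (principalMinor B β)}
          (0<ℝ-resp-≈ℝ {re (δ (elements β))} {re (principalMinor B β)}
            (≈ℝ-sym {re (principalMinor B β)} {re (δ (elements β))}
              (proj₁ (det-tabulate-↭ B {s = element β} refl)))
            (IsPositive-resp-↭ (++-[] (elements β)) pos))
          β<0
      where
      ++-[] : ∀ (xs : List (Fin n)) → xs ++ [] ↭ xs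
      ++-[] xs = ↭-reflexive (++-identityʳ xs)

      len : ∀ (α : Subset n) {k} → ∣ α ∣ ≡ k → length (elements α) ≡ k
      len α eq = ≡.trans (length-tabulate (element α)) eq

      unique : ∀ α → Unique (elements α ++ [])
      unique α = Unique-resp-↭ (↭-sym (++-[] (elements α))) (tabulate⁺ (element-injective α))

Zero-resp-≈ℂ : ∀ z w → z ≈ℂ w → Zero z → Zero w
Zero-resp-≈ℂ z w z≈w = ≈ℂ-trans {w} {z} {0ℂ} (≈ℂ-sym {z} {w} z≈w)

Nonzero-resp-≈ℂ : ∀ z w → z ≈ℂ w → Nonzero z → Nonzero w
Nonzero-resp-≈ℂ z w z≈w z≉0 w≈0 = z≉0 (≈ℂ-trans {z} {w} {0ℂ} z≈w w≈0)

theorem3p4 : ∀ (n : ℕ) (B : Matrix ℂ n) → Hermitian B →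
    ∀ (t : Vector Symbol n) → IsSepr B t →
    ¬ OccursConsecutively A* N t × ¬ OccursConsecutively N A* t
theorem3p4 n B hermitian t sepr = no-A*N , no-NA*
  where
  no-A*N : ¬ OccursConsecutively A* N t
  no-A*N (i , j , j≡1+i , ti≡A* , tj≡N)
    with ≡.subst (IsTerm B (suc (toℕ i))) ti≡A* (sepr i)
       | ≡.subst₂ (λ k → IsTerm B (suc k)) j≡1+i tj≡N (sepr j)
  ... | nonzero , positive , negative | zeros =
    -- `A*` stands at order `suc (toℕ i)`, so `γ` has length `toℕ i`, and the `N` after it covers
    -- `a ∷ b ∷ γ`.
    no-opposite-minors B hermitian (toℕ i)
      (all-minors⇒lists B Nonzero Nonzero-resp-≈ℂ nonzero)
      (λ a b γ unique len → inj₁ (all-minors⇒lists B Zero Zero-resp-≈ℂ zeros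
        (a ∷ b ∷ γ) unique (≡.cong (λ k → suc (suc k)) len)))
      positive negative

  no-NA* : ¬ OccursConsecutively N A* t
  no-NA* (i , j , j≡1+i , ti≡N , tj≡A*)
    with ≡.subst (IsTerm B (suc (toℕ i))) ti≡N (sepr i)
       | ≡.subst₂ (λ k → IsTerm B (suc k)) j≡1+i tj≡A* (sepr j)
  ... | zeros | nonzero , positive , negative =
    -- Now `A*` stands one order higher, so `γ` has length `suc (toℕ i)`, the very order of the `N`
    -- before it.
    no-opposite-minors B hermitian (suc (toℕ i))
      (all-minors⇒lists B Nonzero Nonzero-resp-≈ℂ nonzero)
      (λ { a b γ (_ ∷ _ ∷ unique-γ) len → inj₂
        (all-minors⇒lists B Zero Zero-resp-≈ℂ zeros γ unique-γ len) })
      positive negative
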